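{- Let $(X,\Sigma,\mu)$ be a measure space with $X$ nonempty, let $E$ be a Banach space over $\mathbb{R}$ with norm $\|\cdot\|$, equipped with its Borel $\sigma$-algebra, let $f : X \to E$ be a function and let $(u_n)_{n\in\mathbb{N}}$ be a sequence of elements of $E$. Assume that $f$ is measurable, that for every $y$ in the range of $f$ and every $\varepsilon > 0$ there exists $n\in\mathbb{N}$ such that $\|y-u_n\| < \varepsilon$, and that $\int_{\mathcal{M}_+} \|f\|\, d\mu$ is finite. Then $f$ is Bochner-integrable with regard to $\mu$.
   Context: $\int_{\mathcal{M}_+} g\,d\mu \in [0,+\infty]$ denotes the Lebesgue integral of a nonnegative measurable function $g$, and $\|f\|$ denotes the function $x\mapsto \|f(x)\|$. A function $s : X \to E$ is simple when its range is finite and all preimages $s^{ -1}(\{v\})$, $v\in E$, are measurable. A simple function $s$ is integrable when $\mu(s^{ -1}(\{v\})) < \infty$ for every $v\in E$ with $v\neq 0$. A function $f : X\to E$ is Bochner-integrable (with regard to $\mu$) when there exists a sequence $(s_n)_{n\in\mathbb{N}}$ of integrable simple functions $X\to E$ such that $s_n(x)\to f(x)$ as $n\to\infty$ for all $x\in X$, and $\int_{\mathcal{M}_+}\|f-s_n\|\,d\mu \to 0$ as $n\to\infty$. -}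

module Defs where

open import Level using (Level; 0ℓ; _⊔_) renaming (suc to lsuc)
open import Algebra.Bundles using (CommutativeRing)
open import Algebra.Module.Bundles using (Module)
open import Axiom.ExcludedMiddle using (ExcludedMiddle)
open import Data.Empty using (⊥-elim)
open import Data.List.Base using (List; []; _∷_; map; foldr)
open import Data.Nat.Base as ℕ using (ℕ; zero; suc)
open import Data.Product.Base using (Σ; Σ-syntax; ∃; ∃-syntax; _×_; _,_; proj₁; proj₂)
open import Data.Sum.Base using (_⊎_; inj₁; inj₂)
open import Relation.Binary.Bundles using (Setoid; TotalOrder)
open import Relation.Binary.Core using (Rel)
open import Relation.Binary.PropositionalEquality.Core using (_≢_)
open import Relation.Binary.Structures using (IsTotalOrder)
open import Relation.Nullary using (¬_; yes; no)
open import Relation.Nullary.Decidable using (True; toWitness; fromWitness)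
open import Relation.Unary using (Pred; Satisfiable; ∁; ∅; ⋃; _≐_; _⊥_)

import Algebra.Construct.NaturalChoice.Max as Max
import Data.List.Membership.Setoid as Membership
import Data.List.Relation.Unary.Unique.Setoid as Unique
import Relation.Binary.Construct.Add.Supremum.Equality as AddSupremumEq
import Relation.Binary.Construct.Add.Supremum.NonStrict as AddSupremum
import Relation.Binary.Construct.NonStrictToStrict as ToStrict
import Relation.Binary.Construct.On as On
open import Relation.Nullary.Construct.Add.Supremum using (_⁺; ⊤⁺; [_])

module _ {a ℓ₁ ℓ₂ : Level} {A : Set a} (_≤_ : Rel A ℓ₁) where

  IsUpperBound : Pred A ℓ₂ → Pred A (a ⊔ ℓ₁ ⊔ ℓ₂)
  IsUpperBound S b = ∀ {y} → S y → y ≤ b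

  IsLeastUpperBound : Pred A ℓ₂ → Pred A (a ⊔ ℓ₁ ⊔ ℓ₂)
  IsLeastUpperBound S b = IsUpperBound S b × (∀ {c} → IsUpperBound S c → b ≤ c)

-- The standard library has no real numbers.  They are taken
-- axiomatically, as a Dedekind-complete ordered field, which in
-- classical logic determines them up to isomorphism.  Equality is a
-- setoid equality, so that (with excluded middle) the Cauchy reals are
-- a model.

record CompleteOrderedField : Set₁ where
  infix 4 _≤_

  field
    commutativeRing : CommutativeRing 0ℓ 0ℓ

  open CommutativeRing commutativeRing public

  field
    _≤_          : Rel Carrier 0ℓ
    isTotalOrder : IsTotalOrder _≈_ _≤_
    1≉0          : ¬ 1# ≈ 0#
    inverse      : ∀ x → ¬ x ≈ 0# → ∃[ y ] x * y ≈ 1#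
    +-monoˡ-≤    : ∀ z {x y} → x ≤ y → x + z ≤ y + z
    *-nonneg     : ∀ {x y} → 0# ≤ x → 0# ≤ y → 0# ≤ x * y
    supremum     : (S : Pred Carrier 0ℓ) → Satisfiable S →
                   ∃ (IsUpperBound _≤_ S) → ∃ (IsLeastUpperBound _≤_ S)

  totalOrder : TotalOrder 0ℓ 0ℓ 0ℓ
  totalOrder = record { isTotalOrder = isTotalOrder }

  open IsTotalOrder isTotalOrder public
    using (total; antisym)
    renaming (refl to ≤-refl; reflexive to ≤-reflexive; trans to ≤-trans)

  open ToStrict _≈_ _≤_ public using (_<_)

  open Max totalOrder public using () renaming (_⊔_ to max)

  ∣_∣ : Carrier → Carrier
  ∣ x ∣ = max x (- x)

-- The theory is classical: excluded middle is an explicit parameter.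
-- It also makes it harmless to let subsets of a type be predicates at
-- level 0ℓ, since every predicate is then equivalent to one of these.

module Analysis (em : ∀ {ℓ : Level} → ExcludedMiddle ℓ) (ℝ : CompleteOrderedField) where

  private module ℝ = CompleteOrderedField ℝ
  open ℝ using (_≤_; _<_; ∣_∣; 0#; _+_; _*_)

  ℝ≥0 : Set
  ℝ≥0 = Σ[ x ∈ ℝ.Carrier ] 0# ≤ x

  ℝ≥0-setoid : Setoid 0ℓ 0ℓ
  ℝ≥0-setoid = record
    { isEquivalence = On.isEquivalence {B = ℝ≥0} proj₁ ℝ.isEquivalence }

  open Setoid ℝ≥0-setoid public using () renaming (_≈_ to _≈₀_)

  _≤₀_ : Rel ℝ≥0 0ℓ
  (x , _) ≤₀ (y , _) = x ≤ y

  0₀ : ℝ≥0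
  0₀ = 0# , ℝ.≤-refl

  +-nonneg : ∀ {x y} → 0# ≤ x → 0# ≤ y → 0# ≤ x + y
  +-nonneg {x} {y} 0≤x 0≤y =
    ℝ.≤-trans 0≤y (ℝ.≤-trans (ℝ.≤-reflexive (ℝ.sym (ℝ.+-identityˡ y)))
                              (ℝ.+-monoˡ-≤ y 0≤x))

  [0,∞] : Set
  [0,∞] = ℝ≥0 ⁺

  pattern ∞ = ⊤⁺
  pattern fin x = [ x ]

  open AddSupremumEq _≈₀_ public using () renaming (_≈⁺_ to _≈∞_)
  open AddSupremum _≤₀_ public using () renaming (_≤⁺_ to _≤∞_)
  open ToStrict _≈∞_ _≤∞_ public using () renaming (_<_ to _<∞_)

  IsFinite : Pred [0,∞] 0ℓ
  IsFinite x = x <∞ ∞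

  infixl 6 _+∞_
  infixl 7 _·_

  _+∞_ : [0,∞] → [0,∞] → [0,∞]
  fin (x , 0≤x) +∞ fin (y , 0≤y) = fin (x + y , +-nonneg 0≤x 0≤y)
  fin _         +∞ ∞             = ∞
  ∞             +∞ _             = ∞

  -- With the convention 0 · ∞ = 0.
  _·_ : ℝ≥0 → [0,∞] → [0,∞]
  (x , 0≤x) · fin (y , 0≤y) = fin (x * y , ℝ.*-nonneg 0≤x 0≤y)
  (x , _)   · ∞ with em {P = x ℝ.≈ 0#}
  ... | yes _ = fin 0₀
  ... | no  _ = ∞

  module _ {ℓ : Level} (S : Pred [0,∞] ℓ) where

    -- The finite elements of S, together with 0, as a predicate at
    -- level 0ℓ.
    private
      P : Pred ℝ.Carrier ℓ
      P x = x ℝ.≈ 0# ⊎ (∃[ 0≤x ] S (fin (x , 0≤x)))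

      P₀ : Pred ℝ.Carrier 0ℓ
      P₀ x = True (em {P = P x})

      0∈P₀ : P₀ 0#
      0∈P₀ = fromWitness (inj₁ ℝ.refl)

    sup-exists : ∃ (IsLeastUpperBound _≤∞_ S)
    sup-exists with em {P = Σ[ b ∈ ℝ≥0 ] IsUpperBound _≤∞_ S (fin b)}
    ... | no unbounded = ∞ , (λ {y} _ → y AddSupremum.≤⊤⁺) , least
      where
      least : ∀ {c} → IsUpperBound _≤∞_ S c → ∞ ≤∞ c
      least {fin c} c-ub = ⊥-elim (unbounded (c , c-ub))
      least {∞}     _    = ∞ AddSupremum.≤⊤⁺
    ... | yes ((b , 0≤b) , b-ub) = fin (s , 0≤s) , upper , least
      where
      P₀-bounded : IsUpperBound _≤_ P₀ b
      P₀-bounded x∈P₀ with toWitness x∈P₀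
      ... | inj₁ x≈0       = ℝ.≤-trans (ℝ.≤-reflexive x≈0) 0≤b
      ... | inj₂ (_ , x∈S) with b-ub x∈S
      ...   | AddSupremum.[ x≤b ] = x≤b

      lub : ∃ (IsLeastUpperBound _≤_ P₀)
      lub = ℝ.supremum P₀ (0# , 0∈P₀) (b , P₀-bounded)

      s : ℝ.Carrier
      s = proj₁ lub

      0≤s : 0# ≤ s
      0≤s = proj₁ (proj₂ lub) 0∈P₀

      upper : IsUpperBound _≤∞_ S (fin (s , 0≤s))
      upper {fin (y , 0≤y)} y∈S =
        AddSupremum.[ proj₁ (proj₂ lub) (fromWitness (inj₂ (0≤y , y∈S))) ]
      upper {∞} ∞∈S with b-ub ∞∈S
      ... | ()

      least : ∀ {c} → IsUpperBound _≤∞_ S c → fin (s , 0≤s) ≤∞ c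
      least {∞}             _    = fin (s , 0≤s) AddSupremum.≤⊤⁺
      least {fin (c , 0≤c)} c-ub = AddSupremum.[ proj₂ (proj₂ lub) P₀≤c ]
        where
        P₀≤c : IsUpperBound _≤_ P₀ c
        P₀≤c x∈P₀ with toWitness x∈P₀
        ... | inj₁ x≈0       = ℝ.≤-trans (ℝ.≤-reflexive x≈0) 0≤c
        ... | inj₂ (_ , x∈S) with c-ub x∈S
        ...   | AddSupremum.[ x≤c ] = x≤c

    sup : [0,∞]
    sup = proj₁ sup-exists

    sup-isLeastUpperBound : IsLeastUpperBound _≤∞_ S sup
    sup-isLeastUpperBound = proj₂ sup-exists

  partialSum : (ℕ → [0,∞]) → ℕ → [0,∞]
  partialSum a zero    = fin 0₀
  partialSum a (suc n) = partialSum a n +∞ a n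

  series : (ℕ → [0,∞]) → [0,∞]
  series a = sup (λ s → ∃[ n ] s ≈∞ partialSum a n)

  TendsToZero : (ℕ → [0,∞]) → Set
  TendsToZero a = ∀ (ε : ℝ≥0) → 0# < proj₁ ε →
                  ∃[ N ] ∀ n → N ℕ.≤ n → a n <∞ fin ε

  record MeasureSpace (x m : Level) : Set (lsuc (x ⊔ m ⊔ lsuc 0ℓ)) where
    field
      Point      : Set x
      Measurable : Pred (Pred Point 0ℓ) m

      -- Subsets are compared extensionally, by mutual inclusion.
      measurable-resp : ∀ {A B} → A ≐ B → Measurable A → Measurable B
      ∅-measurable    : Measurable ∅
      ∁-measurable    : ∀ {A} → Measurable A → Measurable (∁ A)
      ⋃-measurable    : ∀ {A : ℕ → Pred Point 0ℓ} →
                        (∀ n → Measurable (A n)) → Measurable (⋃ ℕ A)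

      μ          : ∀ {A} → Measurable A → [0,∞]
      μ-cong     : ∀ {A B} → A ≐ B → (A-meas : Measurable A) (B-meas : Measurable B) →
                   μ A-meas ≈∞ μ B-meas
      μ-∅        : μ ∅-measurable ≈∞ fin 0₀
      μ-additive : ∀ {A : ℕ → Pred Point 0ℓ} (A-meas : ∀ n → Measurable (A n)) →
                   (∀ i j → i ≢ j → A i ⊥ A j) →
                   μ (⋃-measurable A-meas) ≈∞ series (λ n → μ (A-meas n))

  record BanachSpace (e : Level) : Set (lsuc e) where
    field
      vectorSpace : Module ℝ.commutativeRing e 0ℓ

    open Module vectorSpace public

    infixl 6 _-ᴹ_

    _-ᴹ_ : Carrierᴹ → Carrierᴹ → Carrierᴹ
    v -ᴹ w = v +ᴹ (-ᴹ w)

    field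
      ‖_‖            : Carrierᴹ → ℝ.Carrier
      ‖‖-cong        : ∀ {v w} → v ≈ᴹ w → ‖ v ‖ ℝ.≈ ‖ w ‖
      ‖‖-nonneg      : ∀ v → 0# ≤ ‖ v ‖
      ‖‖-definite    : ∀ {v} → ‖ v ‖ ℝ.≈ 0# → v ≈ᴹ 0ᴹ
      ‖‖-homogeneous : ∀ a v → ‖ a *ₗ v ‖ ℝ.≈ ∣ a ∣ * ‖ v ‖
      ‖‖-triangle    : ∀ v w → ‖ v +ᴹ w ‖ ≤ ‖ v ‖ + ‖ w ‖

    setoid : Setoid e 0ℓ
    setoid = record { isEquivalence = ≈ᴹ-isEquivalence }

    norm∞ : Carrierᴹ → [0,∞]
    norm∞ v = fin (‖ v ‖ , ‖‖-nonneg v)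

    IsCauchy : (ℕ → Carrierᴹ) → Set
    IsCauchy v = ∀ ε → 0# < ε →
                 ∃[ N ] ∀ i j → N ℕ.≤ i → N ℕ.≤ j → ‖ v i -ᴹ v j ‖ < ε

    ConvergesTo : (ℕ → Carrierᴹ) → Carrierᴹ → Set
    ConvergesTo v l = ∀ ε → 0# < ε →
                      ∃[ N ] ∀ n → N ℕ.≤ n → ‖ v n -ᴹ l ‖ < ε

    field
      complete : ∀ v → IsCauchy v → ∃[ l ] ConvergesTo v l

    IsOpen : Pred (Pred Carrierᴹ 0ℓ) e
    IsOpen U = ∀ v → U v → ∃[ ε ] 0# < ε × (∀ w → ‖ w -ᴹ v ‖ < ε → U w)

    -- The σ-algebra generated by the open sets.
    data Borel : Pred (Pred Carrierᴹ 0ℓ) (e ⊔ lsuc 0ℓ) where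
      borel-open : ∀ {U} → IsOpen U → Borel U
      borel-resp : ∀ {A B} → A ≐ B → Borel A → Borel B
      borel-∁    : ∀ {A} → Borel A → Borel (∁ A)
      borel-⋃    : ∀ {A : ℕ → Pred Carrierᴹ 0ℓ} → (∀ n → Borel (A n)) → Borel (⋃ ℕ A)

  module _ {x m : Level} (M : MeasureSpace x m) where
    open MeasureSpace M

    module _ {c : Level} (S : Setoid c 0ℓ) where
      open Setoid S
      open Membership S using (_∈_)
      open Unique S using (Unique)

      -- Finiteness of the range is given by a duplicate-free list
      -- containing it; entries outside the range have empty preimage
      -- and contribute 0 to the integral below.
      record IsSimple (s : Point → Carrier) : Set (x ⊔ m ⊔ c) where
        field
          values              : List Carrier
          values-unique       : Unique values
          range⊆values        : ∀ p → s p ∈ values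
          preimage-measurable : ∀ v → Measurable (λ p → s p ≈ v)

    simpleIntegral : ∀ {s} → IsSimple ℝ≥0-setoid s → [0,∞]
    simpleIntegral s-simple =
      foldr _+∞_ (fin 0₀) (map (λ v → v · μ (preimage-measurable v)) values)
      where open IsSimple s-simple

    -- Defined for every g; this is the Lebesgue integral when g is
    -- measurable (and a lower integral otherwise).
    ∫ : (Point → [0,∞]) → [0,∞]
    ∫ g = sup (λ t → Σ[ s ∈ (Point → ℝ≥0) ] Σ[ s-simple ∈ IsSimple ℝ≥0-setoid s ]
                     (∀ p → fin (s p) ≤∞ g p) × t ≈∞ simpleIntegral s-simple)

    module _ {e : Level} (E : BanachSpace e) where
      open BanachSpace E

      IsBorelMeasurable : Pred (Point → Carrierᴹ) (m ⊔ e ⊔ lsuc 0ℓ)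
      IsBorelMeasurable f = ∀ {B} → Borel B → Measurable (λ p → B (f p))

      record IsIntegrableSimple (s : Point → Carrierᴹ) : Set (x ⊔ m ⊔ e) where
        field
          isSimple : IsSimple setoid s

        open IsSimple isSimple public

        field
          preimage-finite : ∀ v → ¬ v ≈ᴹ 0ᴹ → IsFinite (μ (preimage-measurable v))

      IsBochnerIntegrable : Pred (Point → Carrierᴹ) (x ⊔ m ⊔ e)
      IsBochnerIntegrable f =
        Σ[ s ∈ (ℕ → Point → Carrierᴹ) ]
          (∀ n → IsIntegrableSimple (s n)) ×
          (∀ p → ConvergesTo (λ n → s n p) (f p)) ×
          TendsToZero (λ n → ∫ (λ p → norm∞ (f p -ᴹ s n p)))

{-# OPTIONS --safe #-}

-- Let s₀ = 0 and let sₙ₊₁ equal uₙ where uₙ is strictly closer to f than sₙ,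
-- and sₙ elsewhere.  Then ‖f − sₙ‖ ≤ ‖f‖ and ‖f − sₙ‖ ≤ ‖f − uₖ‖ for k < n, which
-- gives pointwise convergence; and ‖sₙ‖ ≤ 2‖f‖, so that by Chebyshev's
-- inequality sₙ is integrable.
--
-- For the L¹ convergence, let φ ≤ ‖f‖ be simple with ∫ φ ≥ ∫ ‖f‖ − ζ, let δ > 0,
-- and let Bₙ be the set where ‖f − uₖ‖ < δ φ for some k < n.  A simple function
-- t ≤ ‖f − sₙ‖ satisfies t ≤ δ φ on Bₙ, while the function equal to φ on Bₙ and
-- to t off Bₙ is a simple minorant of ‖f‖, so the integral of t off Bₙ is at most
-- ∫ ‖f‖ − ∫_Bₙ φ.  Since Bₙ increases to {φ > 0}, this is eventually at most 2ζ.

module Submission where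

open import Defs
open import Level using (Level; 0ℓ; _⊔_) renaming (suc to lsuc)
open import Algebra.Bundles using (CommutativeSemigroup)
open import Axiom.ExcludedMiddle using (ExcludedMiddle)
open import Data.List.Base using (List; []; _∷_; _++_; map; foldr; deduplicate)
open import Data.List.Membership.Setoid.Properties using (∈-++⁺ˡ; ∈-++⁺ʳ; ∈-deduplicate⁺)
open import Data.List.Relation.Unary.All as All using (All; []; _∷_)
open import Data.List.Relation.Unary.AllPairs.Core as AllPairs using (AllPairs)
open import Data.List.Relation.Unary.Any using (here; there)
open import Data.List.Relation.Unary.Unique.DecSetoid.Properties using (deduplicate-!)
open import Data.Nat.Base as ℕ using (ℕ; zero; suc)
import Data.Nat.Properties as ℕ
open import Data.Product.Base using (Σ-syntax; swap; ∃; ∃-syntax; _×_; _,_; proj₁; proj₂)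
open import Data.Sum.Base using (inj₁; inj₂)
open import Function.Base using (_∘_; case_of_)
open import Relation.Binary.Bundles using (DecSetoid; Poset; Setoid; TotalOrder)
open import Relation.Binary.Structures using (IsPartialOrder; IsTotalOrder)
open import Relation.Binary.PropositionalEquality.Core as ≡ using (_≡_; _≢_)
open import Relation.Binary.Construct.NonStrictToStrict using (≮⇒≥)
open import Relation.Binary.Definitions using (Decidable; tri<; tri≈; tri>)
open import Relation.Nullary using (¬_; Dec; yes; no; contradiction)
open import Relation.Nullary.Decidable using (decidable-stable)
open import Relation.Unary using (Pred; Empty; Satisfiable; ∁; ∅; ⋃; _≐_; _⊆_; _⊥_; _∩_; _∪_)

import Algebra.Construct.NaturalChoice.MaxOp as MaxOp
import Algebra.Construct.NaturalChoice.Max as Max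
import Algebra.Properties.AbelianGroup as AbelianGroupProperties
import Algebra.Properties.CommutativeSemigroup as CommutativeSemigroupProperties
import Algebra.Properties.Ring as RingProperties
import Data.List.Membership.Setoid as Membership
import Relation.Binary.Construct.Add.Supremum.Equality as AddSupremumEq
import Relation.Binary.Construct.Add.Supremum.NonStrict as AddSupremum
import Relation.Binary.Construct.On as On
import Relation.Binary.Properties.Poset as PosetProperties
import Relation.Binary.Properties.TotalOrder as TotalOrderProperties
import Relation.Binary.Reasoning.PartialOrder as PartialOrderReasoning
import Relation.Binary.Reasoning.Setoid as SetoidReasoning

-- `∫` is a supremum over simple minorants, so the convergence is proved by bounding one minorant at
-- a time. In place of additivity stands a gluing argument: a simple function below `g` on a set and
-- another below `g` on its complement combine to a single minorant of `g`. The stage from which the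
-- bound holds is found from `φ` and `δ` alone, before any minorant `t` is given, and this
-- uniformity lets the bound pass to the supremum. The threshold is `δ φ` and not a constant because
-- the measure may be infinite: a positive constant can have infinite integral, whereas `δ φ`
-- integrates to at most `δ H`, where `H` is a finite bound for the integral of `‖f‖`; `δ` is chosen
-- so that `δ H ≤ ζ`. The total is three `ζ`: one on the set, and two off it, of which one is the
-- defect of `φ` as an approximation of `‖f‖` and the other what the exhaustion still misses at the
-- given stage. Defining the sets by the distances to the `u k`, not to the approximants, makes them
-- increase by construction.

-- Arithmetic and order in a complete ordered field.

module OrderedFieldProperties (ℝ : CompleteOrderedField) where
  open CompleteOrderedField ℝ
  open RingProperties ring
    using (-‿involutive; -‿distribˡ-*; //-rightDividesˡ; //-rightDividesʳ)
  open TotalOrder totalOrder using (poset)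
  open TotalOrderProperties totalOrder using (≰⇒>; ≰⇒≥) public
  open PosetProperties poset using (<⇒≱) public
  open Poset poset using (≤-respʳ-≈)
  open PartialOrderReasoning poset

  module ℝ-≤-Reasoning = PartialOrderReasoning poset

  <⇒≤ : ∀ {x y} → x < y → x ≤ y
  <⇒≤ = proj₁

  <-≤-trans : ∀ {x y z} → x < y → y ≤ z → x < z
  <-≤-trans {x} {y} {z} x<y y≤z = begin-strict x <⟨ x<y ⟩ y ≤⟨ y≤z ⟩ z ∎

  ≤-<-trans : ∀ {x y z} → x ≤ y → y < z → x < z
  ≤-<-trans {x} {y} {z} x≤y y<z = begin-strict x ≤⟨ x≤y ⟩ y <⟨ y<z ⟩ z ∎

  +-monoʳ-≤ : ∀ z {x y} → x ≤ y → z + x ≤ z + y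
  +-monoʳ-≤ z {x} {y} x≤y = begin
    z + x ≈⟨ +-comm z x ⟩
    x + z ≤⟨ +-monoˡ-≤ z x≤y ⟩
    y + z ≈⟨ +-comm y z ⟩
    z + y ∎

  +-mono-≤ : ∀ {x y u v} → x ≤ y → u ≤ v → x + u ≤ y + v
  +-mono-≤ {y = y} {u = u} x≤y u≤v = ≤-trans (+-monoˡ-≤ u x≤y) (+-monoʳ-≤ y u≤v)

  +-cancelʳ-≤ : ∀ z {x y} → x + z ≤ y + z → x ≤ y
  +-cancelʳ-≤ z {x} {y} x+z≤y+z = begin
    x         ≈⟨ //-rightDividesʳ z x ⟨
    x + z - z ≤⟨ +-monoˡ-≤ (- z) x+z≤y+z ⟩
    y + z - z ≈⟨ //-rightDividesʳ z y ⟩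
    y         ∎

  +-monoˡ-< : ∀ z {x y} → x < y → x + z < y + z
  +-monoˡ-< z x<y@(x≤y , _) =
    +-monoˡ-≤ z x≤y , λ x+z≈y+z → <⇒≱ x<y (+-cancelʳ-≤ z (≤-reflexive (sym x+z≈y+z)))

  +-cancelʳ-< : ∀ z {x y} → x + z < y + z → x < y
  +-cancelʳ-< z (x+z≤y+z , x+z≉y+z) =
    +-cancelʳ-≤ z x+z≤y+z , λ x≈y → x+z≉y+z (+-congʳ x≈y)

  x+x≤y+y⇒x≤y : ∀ {x y} → x + x ≤ y + y → x ≤ y
  x+x≤y+y⇒x≤y {x} {y} x+x≤y+y with total x y
  ... | inj₁ x≤y = x≤y
  ... | inj₂ y≤x = +-cancelʳ-≤ x (≤-trans x+x≤y+y (+-monoʳ-≤ y y≤x))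

  x<y⇒0<y-x : ∀ {x y} → x < y → 0# < y - x
  x<y⇒0<y-x {x} {y} x<y = begin-strict
    0#    ≈⟨ -‿inverseʳ x ⟨
    x - x <⟨ +-monoˡ-< (- x) x<y ⟩
    y - x ∎

  x≤y⇒0≤y-x : ∀ {x y} → x ≤ y → 0# ≤ y - x
  x≤y⇒0≤y-x {x} {y} x≤y = begin
    0#    ≈⟨ -‿inverseʳ x ⟨
    x - x ≤⟨ +-monoˡ-≤ (- x) x≤y ⟩
    y - x ∎

  x-y+y≈x : ∀ x y → x - y + y ≈ x
  x-y+y≈x x y = //-rightDividesˡ y x

  x≤x+y : ∀ x {y} → 0# ≤ y → x ≤ x + y
  x≤x+y x {y} 0≤y = begin
    x      ≈⟨ +-identityʳ x ⟨
    x + 0# ≤⟨ +-monoʳ-≤ x 0≤y ⟩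
    x + y  ∎

  x<x+y : ∀ x {y} → 0# < y → x < x + y
  x<x+y x {y} 0<y = begin-strict
    x      ≈⟨ +-identityˡ x ⟨
    0# + x <⟨ +-monoˡ-< x 0<y ⟩
    y + x  ≈⟨ +-comm y x ⟩
    x + y  ∎

  x≤0⇒0≤-x : ∀ {x} → x ≤ 0# → 0# ≤ - x
  x≤0⇒0≤-x {x} x≤0 = ≤-respʳ-≈ (+-identityˡ (- x)) (x≤y⇒0≤y-x x≤0)

  *-monoʳ-≤ : ∀ {z} → 0# ≤ z → ∀ {x y} → x ≤ y → z * x ≤ z * y
  *-monoʳ-≤ {z} 0≤z {x} {y} x≤y = begin
    z * x                    ≈⟨ +-identityˡ _ ⟨
    0# + z * x               ≤⟨ +-monoˡ-≤ (z * x) (*-nonneg 0≤z (x≤y⇒0≤y-x x≤y)) ⟩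
    z * (y - x) + z * x      ≈⟨ distribˡ z (y - x) x ⟨
    z * (y - x + x)          ≈⟨ *-congˡ (x-y+y≈x y x) ⟩
    z * y                    ∎

  *-monoˡ-≤ : ∀ {z} → 0# ≤ z → ∀ {x y} → x ≤ y → x * z ≤ y * z
  *-monoˡ-≤ {z} 0≤z {x} {y} x≤y = begin
    x * z ≈⟨ *-comm x z ⟩
    z * x ≤⟨ *-monoʳ-≤ 0≤z x≤y ⟩
    z * y ≈⟨ *-comm z y ⟩
    y * z ∎

  0≤1 : 0# ≤ 1#
  0≤1 with total 0# 1#
  ... | inj₁ 0≤1 = 0≤1
  ... | inj₂ 1≤0 = begin
    0#                  ≤⟨ *-nonneg 0≤-1 0≤-1 ⟩
    - 1# * - 1#         ≈⟨ -‿distribˡ-* 1# (- 1#) ⟨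
    - (1# * - 1#)       ≈⟨ -‿cong (*-identityˡ (- 1#)) ⟩
    - - 1#              ≈⟨ -‿involutive 1# ⟩
    1#                  ∎
    where
    0≤-1 : 0# ≤ - 1#
    0≤-1 = x≤0⇒0≤-x 1≤0

  0<1 : 0# < 1#
  0<1 = 0≤1 , 1≉0 ∘ sym

  0<x⇒0<x⁻¹ : ∀ {x y} → 0# < x → x * y ≈ 1# → 0# < y
  0<x⇒0<x⁻¹ {x} {y} (0≤x , _) xy≈1 = ≰⇒> λ y≤0 → <⇒≱ 0<1 (begin
    1#                ≈⟨ xy≈1 ⟨
    x * y             ≤⟨ *-monoʳ-≤ 0≤x y≤0 ⟩
    x * 0#            ≈⟨ zeroʳ x ⟩
    0#                ∎)

  x*y≈0⇒y≈0 : ∀ {x y} → 0# < x → x * y ≈ 0# → y ≈ 0#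
  x*y≈0⇒y≈0 {x} {y} (_ , 0≉x) xy≈0 with inverse x (0≉x ∘ sym)
  ... | z , xz≈1 = begin-equality
    y             ≈⟨ *-identityˡ y ⟨
    1# * y        ≈⟨ *-congʳ xz≈1 ⟨
    x * z * y     ≈⟨ *-congʳ (*-comm x z) ⟩
    z * x * y     ≈⟨ *-assoc z x y ⟩
    z * (x * y)   ≈⟨ *-congˡ xy≈0 ⟩
    z * 0#        ≈⟨ zeroʳ z ⟩
    0#            ∎

  *-positive : ∀ {x y} → 0# < x → 0# < y → 0# < x * y
  *-positive 0<x@(0≤x , _) (0≤y , 0≉y) =
    *-nonneg 0≤x 0≤y , λ 0≈xy → 0≉y (sym (x*y≈0⇒y≈0 0<x (sym 0≈xy)))

  -- `H` may vanish, so `ε` is divided by `H + 1#` instead.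
  ∃-scaling : ∀ {H ε} → 0# ≤ H → 0# < ε → ∃[ δ ] 0# < δ × δ * H ≤ ε
  ∃-scaling {H} {ε} 0≤H 0<ε with inverse (H + 1#) (proj₂ 0<H+1 ∘ sym)
    where
    0<H+1 : 0# < H + 1#
    0<H+1 = ≤-<-trans 0≤H (x<x+y H 0<1)
  ... | i , i-inv = ε * i , 0<δ , (begin
    ε * i * H           ≤⟨ *-monoʳ-≤ (<⇒≤ 0<δ) (x≤x+y H 0≤1) ⟩
    ε * i * (H + 1#)    ≈⟨ *-assoc ε i (H + 1#) ⟩
    ε * (i * (H + 1#))  ≈⟨ *-congˡ (trans (*-comm i (H + 1#)) i-inv) ⟩
    ε * 1#              ≈⟨ *-identityʳ ε ⟩
    ε                   ∎)
    where
    0<δ : 0# < ε * i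
    0<δ = *-positive 0<ε (0<x⇒0<x⁻¹ (≤-<-trans 0≤H (x<x+y H 0<1)) i-inv)

  ∃-half : ∀ {ε} → 0# < ε → ∃[ η ] 0# < η × η + η ≤ ε
  ∃-half {ε} 0<ε with ∃-scaling (≤-trans 0≤1 (x≤x+y 1# 0≤1)) 0<ε
  ... | η , 0<η , η2≤ε = η , 0<η , (begin
    η + η               ≈⟨ +-cong (*-identityʳ η) (*-identityʳ η) ⟨
    η * 1# + η * 1#     ≈⟨ distribˡ η 1# 1# ⟨
    η * (1# + 1#)       ≤⟨ η2≤ε ⟩
    ε                   ∎)

  -- Halving twice leaves room for a fourth `η`, which makes the bound strict, as `TendsToZero`
  -- demands.
  ∃-third : ∀ {ε} → 0# < ε → ∃[ η ] 0# < η × η + (η + η) < ε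
  ∃-third {ε} 0<ε with ∃-half 0<ε
  ... | a , 0<a , a+a≤ε with ∃-half 0<a
  ...   | η , 0<η , η+η≤a = η , 0<η , (begin-strict
    η + (η + η)   ≤⟨ +-monoʳ-≤ η η+η≤a ⟩
    η + a         <⟨ +-monoˡ-< a (<-≤-trans (x<x+y η 0<η) η+η≤a) ⟩
    a + a         ≤⟨ a+a≤ε ⟩
    ε             ∎)

  ∣x∣≈x : ∀ {x} → 0# ≤ x → ∣ x ∣ ≈ x
  ∣x∣≈x {x} 0≤x = Max.x≤y⇒y⊔x≈y totalOrder (begin
    - x      ≈⟨ +-identityˡ (- x) ⟨
    0# - x   ≤⟨ +-monoˡ-≤ (- x) 0≤x ⟩
    x - x    ≈⟨ -‿inverseʳ x ⟩
    0#       ≤⟨ 0≤x ⟩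
    x        ∎)

  ∣-x∣≈∣x∣ : ∀ x → ∣ - x ∣ ≈ ∣ x ∣
  ∣-x∣≈∣x∣ x = trans (⊔-congˡ (- x) (-‿involutive x)) (⊔-comm (- x) x)
    where open MaxOp (Max.maxOperator totalOrder) using (⊔-comm; ⊔-congˡ)

-- Arithmetic in the extended half-line and finite sums.

module ExtendedProperties (em : ∀ {ℓ : Level} → ExcludedMiddle ℓ) (ℝ : CompleteOrderedField) where
  open Analysis em ℝ
  open CompleteOrderedField ℝ
  open OrderedFieldProperties ℝ

  ≤₀-isPartialOrder : IsPartialOrder _≈₀_ _≤₀_
  ≤₀-isPartialOrder = On.isPartialOrder {B = ℝ≥0} proj₁ (IsTotalOrder.isPartialOrder isTotalOrder)

  ∞-poset : Poset 0ℓ 0ℓ 0ℓ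
  ∞-poset = record { isPartialOrder = AddSupremum.≤⁺-isPartialOrder _≤₀_ ≤₀-isPartialOrder }

  open Poset ∞-poset public using ()
    renaming ( refl to ≤∞-refl; reflexive to ≤∞-reflexive; trans to ≤∞-trans; antisym to ≤∞-antisym
             ; module Eq to ≈∞)

  open PartialOrderReasoning ∞-poset

  ∞-minimum : ∀ a → fin 0₀ ≤∞ a
  ∞-minimum (fin (_ , 0≤x)) = AddSupremum.[ 0≤x ]
  ∞-minimum ∞               = _ AddSupremum.≤⊤⁺

  ≤fin⇒finite : ∀ {a b} → a ≤∞ fin b → IsFinite a
  ≤fin⇒finite AddSupremum.[ _ ] = (_ AddSupremum.≤⊤⁺) , λ ()

  finite⇒≤fin : ∀ {a} → IsFinite a → ∃[ b ] a ≤∞ fin b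
  finite⇒≤fin {fin b} _         = b , ≤∞-refl
  finite⇒≤fin {∞}     (_ , ∞≉∞) = contradiction ≈∞.refl ∞≉∞

  ≤fin∧<⇒<∞ : ∀ {a b c} → a ≤∞ fin b → proj₁ b < proj₁ c → a <∞ fin c
  ≤fin∧<⇒<∞ AddSupremum.[ a≤b ] b<c =
    let a≤c , a≉c = ≤-<-trans a≤b b<c in AddSupremum.[ a≤c ] , λ { AddSupremumEq.[ a≈c ] → a≉c a≈c }

  +∞-cong : ∀ {a a′ b b′} → a ≈∞ a′ → b ≈∞ b′ → a +∞ b ≈∞ a′ +∞ b′
  +∞-cong AddSupremumEq.[ p ] AddSupremumEq.[ q ] = AddSupremumEq.[ +-cong p q ]
  +∞-cong AddSupremumEq.[ p ] AddSupremumEq.⊤⁺≈⊤⁺ = ≈∞.refl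
  +∞-cong AddSupremumEq.⊤⁺≈⊤⁺ _                   = ≈∞.refl

  +∞-assoc : ∀ a b c → (a +∞ b) +∞ c ≈∞ a +∞ (b +∞ c)
  +∞-assoc (fin (x , _)) (fin (y , _)) (fin (z , _)) = AddSupremumEq.[ +-assoc x y z ]
  +∞-assoc (fin _)       (fin _)       ∞             = ≈∞.refl
  +∞-assoc (fin _)       ∞             _             = ≈∞.refl
  +∞-assoc ∞             _             _             = ≈∞.refl

  +∞-comm : ∀ a b → a +∞ b ≈∞ b +∞ a
  +∞-comm (fin (x , _)) (fin (y , _)) = AddSupremumEq.[ +-comm x y ]
  +∞-comm (fin _)       ∞             = ≈∞.refl
  +∞-comm ∞             (fin _)       = ≈∞.refl
  +∞-comm ∞             ∞             = ≈∞.refl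

  +∞-identityˡ : ∀ a → fin 0₀ +∞ a ≈∞ a
  +∞-identityˡ (fin (x , _)) = AddSupremumEq.[ +-identityˡ x ]
  +∞-identityˡ ∞             = ≈∞.refl

  +∞-identityʳ : ∀ a → a +∞ fin 0₀ ≈∞ a
  +∞-identityʳ a = ≈∞.trans (+∞-comm a (fin 0₀)) (+∞-identityˡ a)

  +∞-mono : ∀ {a a′ b b′} → a ≤∞ a′ → b ≤∞ b′ → a +∞ b ≤∞ a′ +∞ b′
  +∞-mono AddSupremum.[ p ]           AddSupremum.[ q ]           = AddSupremum.[ +-mono-≤ p q ]
  +∞-mono {b = fin _} AddSupremum.[ _ ] (_ AddSupremum.≤⊤⁺)       = _ AddSupremum.≤⊤⁺
  +∞-mono {b = ∞}     AddSupremum.[ _ ] (_ AddSupremum.≤⊤⁺)       = _ AddSupremum.≤⊤⁺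
  +∞-mono (_ AddSupremum.≤⊤⁺)         _                           = _ AddSupremum.≤⊤⁺

  a≤∞a+∞b : ∀ a b → a ≤∞ a +∞ b
  a≤∞a+∞b a b = ≤∞-trans (≤∞-reflexive (≈∞.sym (+∞-identityʳ a))) (+∞-mono ≤∞-refl (∞-minimum b))

  +∞-cancelʳ-≤ : ∀ {a b c} → IsFinite c → a +∞ c ≤∞ b +∞ c → a ≤∞ b
  +∞-cancelʳ-≤ {fin _} {fin _} {fin (z , _)} _ AddSupremum.[ p ] = AddSupremum.[ +-cancelʳ-≤ z p ]
  +∞-cancelʳ-≤ {∞} {fin _} {fin _} _ ()
  +∞-cancelʳ-≤ {∞} {fin _} {∞} (_ , ∞≉∞) _ = contradiction ≈∞.refl ∞≉∞
  +∞-cancelʳ-≤ {_} {∞} _ _ = _ AddSupremum.≤⊤⁺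
  +∞-cancelʳ-≤ {fin _} {fin _} {∞} (_ , ∞≉∞) _ = contradiction ≈∞.refl ∞≉∞

  +∞-commutativeSemigroup : CommutativeSemigroup 0ℓ 0ℓ
  +∞-commutativeSemigroup = record
    { isCommutativeSemigroup = record
      { isSemigroup = record
        { isMagma = record { isEquivalence = ≈∞.isEquivalence ; ∙-cong = +∞-cong }
        ; assoc   = +∞-assoc }
      ; comm = +∞-comm } }

  open CommutativeSemigroupProperties +∞-commutativeSemigroup public using (interchange)

  0·a≈0 : ∀ x → proj₁ x ≈ 0# → ∀ a → x · a ≈∞ fin 0₀
  0·a≈0 _ x≈0 (fin (y , _)) = AddSupremumEq.[ trans (*-congʳ x≈0) (zeroˡ y) ]
  0·a≈0 (x , _) x≈0 ∞ with em {P = x ≈ 0#}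
  ... | yes _  = ≈∞.refl
  ... | no x≉0 = contradiction x≈0 x≉0

  x·∞≈∞ : ∀ x → ¬ proj₁ x ≈ 0# → x · ∞ ≈∞ ∞
  x·∞≈∞ (x , _) x≉0 with em {P = x ≈ 0#}
  ... | yes x≈0 = contradiction x≈0 x≉0
  ... | no _    = ≈∞.refl

  ·-zeroʳ : ∀ x {a} → a ≈∞ fin 0₀ → x · a ≈∞ fin 0₀
  ·-zeroʳ (x , _) AddSupremumEq.[ a≈0 ] = AddSupremumEq.[ trans (*-congˡ a≈0) (zeroʳ x) ]

  ·-monoˡ : ∀ {x y} → x ≤₀ y → ∀ a → x · a ≤∞ y · a
  ·-monoˡ x≤y (fin (_ , 0≤z)) = AddSupremum.[ *-monoˡ-≤ 0≤z x≤y ]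
  ·-monoˡ {x , 0≤x} {y , _} x≤y ∞ with em {P = y ≈ 0#}
  ... | yes y≈0 = ≤∞-reflexive (0·a≈0 (x , 0≤x) (antisym (≤-trans x≤y (≤-reflexive y≈0)) 0≤x) ∞)
  ... | no  _   = _ AddSupremum.≤⊤⁺

  ·-monoʳ : ∀ x {a b} → a ≤∞ b → x · a ≤∞ x · b
  ·-monoʳ (_ , 0≤x) AddSupremum.[ a≤b ] = AddSupremum.[ *-monoʳ-≤ 0≤x a≤b ]
  ·-monoʳ x@(x′ , _) (a AddSupremum.≤⊤⁺) with em {P = x′ ≈ 0#}
  ... | yes x≈0 = ≤∞-reflexive (0·a≈0 x x≈0 a)
  ... | no  _   = _ AddSupremum.≤⊤⁺

  ·-congˡ : ∀ x {a b} → a ≈∞ b → x · a ≈∞ x · b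
  ·-congˡ x a≈b = ≤∞-antisym (·-monoʳ x (≤∞-reflexive a≈b)) (·-monoʳ x (≤∞-reflexive (≈∞.sym a≈b)))

  -- `x · ∞` is zero or infinite according to whether `x` vanishes, and it swallows `x · a` either
  -- way. This is distributivity in the case of an infinite summand.
  ·-absorbs-∞ : ∀ x a → x · a +∞ x · ∞ ≈∞ x · ∞
  ·-absorbs-∞ x a = by-cases (em {P = proj₁ x ≈ 0#})
    where
    by-cases : Dec (proj₁ x ≈ 0#) → x · a +∞ x · ∞ ≈∞ x · ∞
    by-cases (yes x≈0) = ≈∞.trans (+∞-cong (0·a≈0 x x≈0 a) ≈∞.refl) (+∞-identityˡ _)
    by-cases (no  x≉0) = begin-equality
      x · a +∞ x · ∞  ≈⟨ +∞-cong ≈∞.refl (x·∞≈∞ x x≉0) ⟩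
      x · a +∞ ∞      ≈⟨ +∞-comm (x · a) ∞ ⟩
      ∞               ≈⟨ x·∞≈∞ x x≉0 ⟨
      x · ∞           ∎

  ·-distribˡ-+∞ : ∀ x a b → x · (a +∞ b) ≈∞ x · a +∞ x · b
  ·-distribˡ-+∞ (x , _) (fin (y , _)) (fin (z , _)) = AddSupremumEq.[ distribˡ x y z ]
  ·-distribˡ-+∞ x       a@(fin _)     ∞             = ≈∞.sym (·-absorbs-∞ x a)
  ·-distribˡ-+∞ x       ∞             b             =
    ≈∞.trans (≈∞.sym (·-absorbs-∞ x b)) (+∞-comm (x · b) (x · ∞))

  infixl 7 _*₀_

  _*₀_ : ℝ≥0 → ℝ≥0 → ℝ≥0
  (x , 0≤x) *₀ (y , 0≤y) = x * y , *-nonneg 0≤x 0≤y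

  ·-assoc-≤ : ∀ {x} → 0# < proj₁ x → ∀ y a → (x *₀ y) · a ≤∞ x · (y · a)
  ·-assoc-≤ {x , _} _ (y , _) (fin (z , _)) = AddSupremum.[ ≤-reflexive (*-assoc x y z) ]
  ·-assoc-≤ {x} 0<x@(_ , 0≉x) y ∞ = by-cases (em {P = proj₁ y ≈ 0#})
    where
    by-cases : Dec (proj₁ y ≈ 0#) → (x *₀ y) · ∞ ≤∞ x · (y · ∞)
    by-cases (yes y≈0) = ≤∞-trans (≤∞-reflexive (0·a≈0 (x *₀ y) (trans (*-congˡ y≈0) (zeroʳ _)) ∞)) (∞-minimum _)
    by-cases (no  y≉0) = begin
      (x *₀ y) · ∞  ≤⟨ _ AddSupremum.≤⊤⁺ ⟩
      ∞             ≈⟨ x·∞≈∞ x (0≉x ∘ sym) ⟨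
      x · ∞         ≈⟨ ·-congˡ x (x·∞≈∞ y y≉0) ⟨
      x · (y · ∞)   ∎

  ·-finite⁻¹ : ∀ x {a} → ¬ proj₁ x ≈ 0# → IsFinite (x · a) → IsFinite a
  ·-finite⁻¹ x {fin _} _   _     = (_ AddSupremum.≤⊤⁺) , λ ()
  ·-finite⁻¹ x {∞}     x≉0 x·∞<∞ = contradiction (x·∞≈∞ x x≉0) (proj₂ x·∞<∞)

  -- If no element came within `η` of `s`, then `s - η` would be a smaller upper bound. The finite
  -- bound on `s` makes the subtraction meaningful, and an element of `S` ensures `η ≤ s`, so that
  -- the difference stays in the half-line.
  supremum-approximated : ∀ {ℓ} {S : [0,∞] → Set ℓ} {s m} → IsLeastUpperBound _≤∞_ S s → s ≤∞ fin m →
                          ∃ S → ∀ η → 0# < proj₁ η → ∃[ a ] S a × s ≤∞ a +∞ fin η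
  supremum-approximated {S = S} {fin (s , 0≤s)} (_ , s-least) _ (b , b∈S) (η , 0≤η) 0<η
    with em {P = ∃[ a ] S a × fin (s , 0≤s) ≤∞ a +∞ fin (η , 0≤η)}
  ... | yes close = close
  ... | no  apart = contradiction s≤s-η (<⇒≱ s-η<s)
    where
    below : ∀ {a} → S a → ∃[ x ] a ≡ fin x × proj₁ x + η ≤ s
    below {fin (x , 0≤x)} a∈S =
      (x , 0≤x) , ≡.refl , ≰⇒≥ (λ s≤x+η → apart (_ , a∈S , AddSupremum.[ s≤x+η ]))
    below {∞} a∈S = contradiction (_ , a∈S , (_ AddSupremum.≤⊤⁺)) apart

    η≤s : η ≤ s
    η≤s with below b∈S
    ... | (x , 0≤x) , _ , x+η≤s =
      ≤-trans (≤-trans (x≤x+y η 0≤x) (≤-reflexive (+-comm η x))) x+η≤s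

    s-η-upper : IsUpperBound _≤∞_ S (fin (s - η , x≤y⇒0≤y-x η≤s))
    s-η-upper a∈S with below a∈S
    ... | _ , ≡.refl , x+η≤s =
      AddSupremum.[ +-cancelʳ-≤ η (≤-trans x+η≤s (≤-reflexive (sym (x-y+y≈x s η)))) ]

    s≤s-η : s ≤ s - η
    s≤s-η with s-least s-η-upper
    ... | AddSupremum.[ p ] = p

    s-η<s : s - η < s
    s-η<s = <-≤-trans (x<x+y (s - η) 0<η) (≤-reflexive (x-y+y≈x s η))

  module _ {c : Level} {A : Set c} where

    -- Has the shape of `simpleIntegral`, so that simple integrals are instances of it by
    -- definition.
    ∑ : List A → (A → [0,∞]) → [0,∞]
    ∑ L F = foldr _+∞_ (fin 0₀) (map F L)

    ∑-mono-All : ∀ {F G} L → All (λ v → F v ≤∞ G v) L → ∑ L F ≤∞ ∑ L G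
    ∑-mono-All []      []       = ≤∞-refl
    ∑-mono-All (v ∷ L) (p ∷ ps) = +∞-mono p (∑-mono-All L ps)

    ∑-cong-All : ∀ {F G} L → All (λ v → F v ≈∞ G v) L → ∑ L F ≈∞ ∑ L G
    ∑-cong-All L ps = ≤∞-antisym (∑-mono-All L (All.map ≤∞-reflexive ps))
                                 (∑-mono-All L (All.map (≤∞-reflexive ∘ ≈∞.sym) ps))

    ∑-mono : ∀ {F G} L → (∀ v → F v ≤∞ G v) → ∑ L F ≤∞ ∑ L G
    ∑-mono L F≤G = ∑-mono-All L (All.universal F≤G L)

    ∑-cong : ∀ {F G} L → (∀ v → F v ≈∞ G v) → ∑ L F ≈∞ ∑ L G
    ∑-cong L F≈G = ∑-cong-All L (All.universal F≈G L)

    ∑-distrib-+∞ : ∀ L (F G : A → [0,∞]) → ∑ L (λ v → F v +∞ G v) ≈∞ ∑ L F +∞ ∑ L G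
    ∑-distrib-+∞ []      F G = ≈∞.sym (+∞-identityˡ _)
    ∑-distrib-+∞ (v ∷ L) F G = ≈∞.trans (+∞-cong ≈∞.refl (∑-distrib-+∞ L F G))
                                        (interchange (F v) (G v) (∑ L F) (∑ L G))

    ∑-zero : ∀ (L : List A) → ∑ L (λ _ → fin 0₀) ≈∞ fin 0₀
    ∑-zero []      = ≈∞.refl
    ∑-zero (v ∷ L) = ≈∞.trans (+∞-identityˡ _) (∑-zero L)

    ·-distribˡ-∑ : ∀ x L (F : A → [0,∞]) → x · ∑ L F ≈∞ ∑ L (λ v → x · F v)
    ·-distribˡ-∑ x []      F = ·-zeroʳ x ≈∞.refl
    ·-distribˡ-∑ x (v ∷ L) F =
      ≈∞.trans (·-distribˡ-+∞ x (F v) (∑ L F)) (+∞-cong ≈∞.refl (·-distribˡ-∑ x L F))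

  ∑-swap : ∀ {c d} {A : Set c} {B : Set d} (L : List A) (K : List B) (F : A → B → [0,∞]) →
           ∑ L (λ v → ∑ K (F v)) ≈∞ ∑ K (λ w → ∑ L (λ v → F v w))
  ∑-swap []      K F = ≈∞.sym (∑-zero K)
  ∑-swap (v ∷ L) K F = begin-equality
    ∑ K (F v) +∞ ∑ L (λ v → ∑ K (F v))        ≈⟨ +∞-cong ≈∞.refl (∑-swap L K F) ⟩
    ∑ K (F v) +∞ ∑ K (λ w → ∑ L (λ v → F v w)) ≈⟨ ∑-distrib-+∞ K (F v) _ ⟨
    ∑ K (λ w → F v w +∞ ∑ L (λ v → F v w))    ∎

  ·-identityˡ : ∀ {0≤1 : 0# ≤ 1#} a → (1# , 0≤1) · a ≈∞ a
  ·-identityˡ (fin (x , _)) = AddSupremumEq.[ *-identityˡ x ]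
  ·-identityˡ {p} ∞         = x·∞≈∞ (1# , p) 1≉0

-- Finite additivity and continuity of the measure.

module MeasureProperties
  (em : ∀ {ℓ : Level} → ExcludedMiddle ℓ) (ℝ : CompleteOrderedField)
  {x m : Level} (M : Analysis.MeasureSpace em ℝ x m) where

  open Analysis em ℝ
  open CompleteOrderedField ℝ using (_≤_; _<_; 0#; 1#; _*_)
  private module ℝ = CompleteOrderedField ℝ
  open OrderedFieldProperties ℝ
  open ExtendedProperties em ℝ
  open MeasureSpace M
  open PartialOrderReasoning ∞-poset

  ∪-sequence : (A B : Pred Point 0ℓ) → ℕ → Pred Point 0ℓ
  ∪-sequence A B zero          = A
  ∪-sequence A B (suc zero)    = B
  ∪-sequence A B (suc (suc _)) = ∅

  ∪-sequence-measurable : ∀ {A B} → Measurable A → Measurable B → ∀ n → Measurable (∪-sequence A B n)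
  ∪-sequence-measurable A-meas B-meas zero          = A-meas
  ∪-sequence-measurable A-meas B-meas (suc zero)    = B-meas
  ∪-sequence-measurable A-meas B-meas (suc (suc _)) = ∅-measurable

  ⋃-∪-sequence : ∀ {A B} → ⋃ ℕ (∪-sequence A B) ≐ A ∪ B
  ⋃-∪-sequence {A} {B} = to , λ { (inj₁ a) → 0 , a ; (inj₂ b) → 1 , b }
    where
    to : ⋃ ℕ (∪-sequence A B) ⊆ A ∪ B
    to (zero , a)     = inj₁ a
    to (suc zero , b) = inj₂ b

  ∪-measurable : ∀ {A B} → Measurable A → Measurable B → Measurable (A ∪ B)
  ∪-measurable A-meas B-meas =
    measurable-resp ⋃-∪-sequence (⋃-measurable (∪-sequence-measurable A-meas B-meas))

  ∩-measurable : ∀ {A B} → Measurable A → Measurable B → Measurable (A ∩ B)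
  ∩-measurable {A} {B} A-meas B-meas =
    measurable-resp (to , λ { (a , b) (inj₁ ¬a) → ¬a a ; (a , b) (inj₂ ¬b) → ¬b b })
                    (∁-measurable (∪-measurable (∁-measurable A-meas) (∁-measurable B-meas)))
    where
    to : ∁ (∁ A ∪ ∁ B) ⊆ A ∩ B
    to h = decidable-stable em (h ∘ inj₁) , decidable-stable em (h ∘ inj₂)

  constant-measurable : (Q : Set) → Measurable (λ _ → Q)
  constant-measurable Q with em {P = Q}
  ... | yes q = measurable-resp ((λ _ → q) , λ _ ()) (∁-measurable ∅-measurable)
  ... | no ¬q = measurable-resp ((λ ()) , ¬q) ∅-measurable

  -- `μ` is a function of the measurability proof, so each set travels with one; `measure-cong`
  -- shows that the choice of proof does not affect the value.
  MeasurableSet : Set (lsuc 0ℓ ⊔ x ⊔ m)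
  MeasurableSet = ∃ Measurable

  infixr 7 _∩ₘ_

  _∩ₘ_ : MeasurableSet → MeasurableSet → MeasurableSet
  (_ , A-meas) ∩ₘ (_ , B-meas) = _ , ∩-measurable A-meas B-meas

  ∁ₘ : MeasurableSet → MeasurableSet
  ∁ₘ (_ , A-meas) = _ , ∁-measurable A-meas

  measure : MeasurableSet → [0,∞]
  measure (_ , A-meas) = μ A-meas

  measure-cong : ∀ A B → proj₁ A ≐ proj₁ B → measure A ≈∞ measure B
  measure-cong (_ , A-meas) (_ , B-meas) A≐B = μ-cong A≐B A-meas B-meas

  measure-empty : ∀ A → Empty (proj₁ A) → measure A ≈∞ fin 0₀
  measure-empty A A-empty =
    ≈∞.trans (measure-cong A (∅ , ∅-measurable) ((λ {p} → A-empty p) , λ ())) μ-∅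

  -- Countable additivity for the sequence `A`, `B`, `∅`, `∅`, ...: the partial sums are constant
  -- from index 2 on, so that one is their supremum. `C` is a separate argument so that any
  -- measurability proof of the union can be used.
  measure-⊎ : ∀ A B C → proj₁ A ⊥ proj₁ B → proj₁ C ≐ proj₁ A ∪ proj₁ B →
              measure C ≈∞ measure A +∞ measure B
  measure-⊎ (A , A-meas) (B , B-meas) C A⊥B (C⊆ , ⊆C) = begin-equality
    measure C              ≈⟨ measure-cong C (_ , ⋃-measurable D-meas)
                                ((proj₂ ⋃-∪-sequence ∘ C⊆) , (⊆C ∘ proj₁ ⋃-∪-sequence)) ⟩
    μ (⋃-measurable D-meas) ≈⟨ μ-additive D-meas disjoint ⟩
    series (λ n → μ (D-meas n)) ≈⟨ ≤∞-antisym (proj₂ sup-lub upper) (proj₁ sup-lub (2 , two)) ⟩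
    μ A-meas +∞ μ B-meas   ∎
    where
    D-meas : ∀ n → Measurable (∪-sequence A B n)
    D-meas = ∪-sequence-measurable A-meas B-meas

    disjoint : ∀ i j → i ≢ j → ∪-sequence A B i ⊥ ∪-sequence A B j
    disjoint zero          zero          i≢j _       = i≢j ≡.refl
    disjoint zero          (suc zero)    _   (a , b) = A⊥B (a , b)
    disjoint (suc zero)    zero          _   (b , a) = A⊥B (a , b)
    disjoint (suc zero)    (suc zero)    i≢j _       = i≢j ≡.refl
    disjoint (suc (suc _)) _             _   (() , _)
    disjoint _             (suc (suc _)) _   (_ , ())

    sums : ℕ → [0,∞]
    sums = partialSum (λ n → μ (D-meas n))

    sup-lub : IsLeastUpperBound _≤∞_ (λ s → ∃[ n ] s ≈∞ sums n) (series (λ n → μ (D-meas n)))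
    sup-lub = sup-isLeastUpperBound _

    two : μ A-meas +∞ μ B-meas ≈∞ sums 2
    two = +∞-cong (≈∞.sym (+∞-identityˡ _)) ≈∞.refl

    sums-stable : ∀ n → sums (2 ℕ.+ n) ≈∞ sums 2
    sums-stable zero    = ≈∞.refl
    sums-stable (suc n) = ≈∞.trans (+∞-cong (sums-stable n) μ-∅) (+∞-identityʳ _)

    sums-≤ : ∀ n → sums n ≤∞ μ A-meas +∞ μ B-meas
    sums-≤ zero          = ∞-minimum _
    sums-≤ (suc zero)    = ≤∞-trans (≤∞-reflexive (+∞-identityˡ _)) (a≤∞a+∞b _ _)
    sums-≤ (suc (suc n)) = ≤∞-reflexive (≈∞.trans (sums-stable n) (≈∞.sym two))

    upper : IsUpperBound _≤∞_ (λ s → ∃[ n ] s ≈∞ sums n) (μ A-meas +∞ μ B-meas)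
    upper (n , s≈) = ≤∞-trans (≤∞-reflexive s≈) (sums-≤ n)

  measure-split : ∀ A B → measure A ≈∞ measure (B ∩ₘ A) +∞ measure (∁ₘ B ∩ₘ A)
  measure-split A B = measure-⊎ (B ∩ₘ A) (∁ₘ B ∩ₘ A) A (λ { ((b , _) , (¬b , _)) → ¬b b })
    (split , λ { (inj₁ (_ , a)) → a ; (inj₂ (_ , a)) → a })
    where
    split : proj₁ A ⊆ proj₁ (B ∩ₘ A) ∪ proj₁ (∁ₘ B ∩ₘ A)
    split {p} a with em {P = proj₁ B p}
    ... | yes b = inj₁ (b , a)
    ... | no ¬b = inj₂ (¬b , a)

  measure-mono : ∀ A B → proj₁ A ⊆ proj₁ B → measure A ≤∞ measure B
  measure-mono A B A⊆B = begin
    measure A                                 ≈⟨ measure-cong A (A ∩ₘ B) ((λ a → a , A⊆B a) , proj₁) ⟩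
    measure (A ∩ₘ B)                          ≤⟨ a≤∞a+∞b _ _ ⟩
    measure (A ∩ₘ B) +∞ measure (∁ₘ A ∩ₘ B)   ≈⟨ measure-split B A ⟨
    measure B                                 ∎

  -- The indices are those strictly below `n`, matching the points `u k` that `nearest n` has
  -- already been compared with.
  firstₘ : (ℕ → MeasurableSet) → ℕ → MeasurableSet
  firstₘ A zero    = ∅ , ∅-measurable
  firstₘ A (suc n) = _ , ∪-measurable (proj₂ (firstₘ A n)) (proj₂ (A n))

  firstₘ-mono : ∀ A {i j} → i ℕ.≤′ j → proj₁ (firstₘ A i) ⊆ proj₁ (firstₘ A j)
  firstₘ-mono A ℕ.≤′-refl       = λ a → a
  firstₘ-mono A (ℕ.≤′-step i≤j) = inj₁ ∘ firstₘ-mono A i≤j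

  firstₘ⁻ : ∀ A n {p} → proj₁ (firstₘ A n) p → ∃[ k ] k ℕ.< n × proj₁ (A k) p
  firstₘ⁻ A (suc n) (inj₁ p∈) with firstₘ⁻ A n p∈
  ... | k , k<n , a = k , ℕ.m<n⇒m<1+n k<n , a
  firstₘ⁻ A (suc n) (inj₂ a) = n , ℕ.n<1+n n , a

  module _ (A : ℕ → MeasurableSet) (C : MeasurableSet) (C⊆⋃A : proj₁ C ⊆ ⋃ ℕ (proj₁ ∘ A)) where
    private
      fresh : ℕ → MeasurableSet
      fresh n = ∁ₘ (firstₘ A n) ∩ₘ A n ∩ₘ C

      fresh-disjoint-< : ∀ {i j} → i ℕ.< j → proj₁ (fresh i) ⊥ proj₁ (fresh j)
      fresh-disjoint-< i<j ((_ , a , _) , (¬a , _)) = ¬a (firstₘ-mono A (ℕ.≤⇒≤′ i<j) (inj₂ a))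

      fresh-disjoint : ∀ i j → i ≢ j → proj₁ (fresh i) ⊥ proj₁ (fresh j)
      fresh-disjoint i j i≢j (p , q) with ℕ.<-cmp i j
      ... | tri< i<j _ _ = fresh-disjoint-< i<j (p , q)
      ... | tri≈ _ i≡j _ = i≢j i≡j
      ... | tri> _ _ j<i = fresh-disjoint-< j<i (q , p)

      -- Descent on `n`, by excluded middle, to the first index at which the point occurs.
      first-fresh : ∀ n {p} → proj₁ C p → proj₁ (firstₘ A n) p → ∃[ k ] proj₁ (fresh k) p
      first-fresh (suc n) {p} c p∈ with em {P = proj₁ (firstₘ A n) p}
      ... | yes earlier = first-fresh n c earlier
      first-fresh (suc n) c (inj₁ p∈) | no new = contradiction p∈ new
      first-fresh (suc n) c (inj₂ a)  | no new = n , new , a , c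

      partialSum-fresh : ∀ n → partialSum (measure ∘ fresh) n ≈∞ measure (firstₘ A n ∩ₘ C)
      partialSum-fresh zero    = ≈∞.sym (measure-empty (firstₘ A zero ∩ₘ C) (λ _ ()))
      partialSum-fresh (suc n) = ≈∞.trans (+∞-cong (partialSum-fresh n) ≈∞.refl)
        (≈∞.sym (measure-⊎ (firstₘ A n ∩ₘ C) (fresh n) (firstₘ A (suc n) ∩ₘ C)
          (λ { ((old , _) , (new , _)) → new old })
          (to , λ { (inj₁ (old , c)) → inj₁ old , c ; (inj₂ (_ , a , c)) → inj₂ a , c })))
        where
        to : proj₁ (firstₘ A (suc n) ∩ₘ C) ⊆ proj₁ (firstₘ A n ∩ₘ C) ∪ proj₁ (fresh n)
        to {p} (p∈ , c) with em {P = proj₁ (firstₘ A n) p}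
        ... | yes old = inj₁ (old , c)
        to (inj₁ old , c) | no new = contradiction old new
        to (inj₂ a , c)   | no new = inj₂ (new , a , c)

      measure≈series : measure C ≈∞ series (measure ∘ fresh)
      measure≈series = ≈∞.trans
        (measure-cong C (_ , ⋃-measurable (proj₂ ∘ fresh))
          ((λ c → let k , a = C⊆⋃A c in first-fresh (suc k) c (inj₂ a)) , λ { (_ , _ , _ , c) → c }))
        (μ-additive (proj₂ ∘ fresh) fresh-disjoint)

    -- The pieces `fresh k` are disjoint and their partial sums are the measures of
    -- `firstₘ A n ∩ₘ C`, so `measure C` is the supremum of the latter; being finite, it can be
    -- approximated within `η`. The error is added on the right to avoid subtraction of extended
    -- numbers.
    measure-continuous : IsFinite (measure C) → ∀ η → 0# < proj₁ η →
                         ∃[ N ] ∀ n → N ℕ.≤ n → measure C ≤∞ measure (firstₘ A n ∩ₘ C) +∞ fin η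
    measure-continuous C-finite η 0<η =
      let b , C≤b = finite⇒≤fin C-finite
          a , (N , a≈) , series≤ = supremum-approximated (sup-isLeastUpperBound _)
            (≤∞-trans (≤∞-reflexive (≈∞.sym measure≈series)) C≤b) (_ , 0 , ≈∞.refl) η 0<η
      in N , λ n N≤n → begin
        measure C                             ≈⟨ measure≈series ⟩
        series (measure ∘ fresh)              ≤⟨ series≤ ⟩
        a +∞ fin η                            ≈⟨ +∞-cong (≈∞.trans a≈ (partialSum-fresh N)) ≈∞.refl ⟩
        measure (firstₘ A N ∩ₘ C) +∞ fin η    ≤⟨ +∞-mono (measure-mono (firstₘ A N ∩ₘ C) (firstₘ A n ∩ₘ C)
                                                   (λ { (p , c) → firstₘ-mono A (ℕ.≤⇒≤′ N≤n) p , c })) ≤∞-refl ⟩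
        measure (firstₘ A n ∩ₘ C) +∞ fin η    ∎

  -- Simple functions and their level sets.

  module _ {c : Level} (S : Setoid c 0ℓ) where
    open Setoid S
    open Membership S using (_∈_)

    preimage : ∀ {s} → IsSimple M S s → Carrier → MeasurableSet
    preimage s-simple v = _ , IsSimple.preimage-measurable s-simple v

    constant-simple : ∀ v → IsSimple M S (λ _ → v)
    constant-simple v = record
      { values              = v ∷ []
      ; values-unique       = [] AllPairs.∷ AllPairs.[]
      ; range⊆values        = λ _ → here refl
      ; preimage-measurable = λ w → constant-measurable (v ≈ w)
      }

    piecewise : Pred Point 0ℓ → (s t : Point → Carrier) → Point → Carrier
    piecewise B s t p with em {P = B p}
    ... | yes _ = s p
    ... | no  _ = t p

    piecewise-∈ : ∀ B s t {p} → B p → piecewise B s t p ≈ s p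
    piecewise-∈ B s t {p} b with em {P = B p}
    ... | yes _ = refl
    ... | no ¬b = contradiction b ¬b

    piecewise-∉ : ∀ B s t {p} → ¬ B p → piecewise B s t p ≈ t p
    piecewise-∉ B s t {p} ¬b with em {P = B p}
    ... | yes b = contradiction b ¬b
    ... | no _  = refl

    piecewise-simple : ∀ {s t} ((B , _) : MeasurableSet) → IsSimple M S s → IsSimple M S t →
                       IsSimple M S (piecewise B s t)
    piecewise-simple {s} {t} (B , B-meas) s-simple t-simple = record
      -- The two functions may share values, and a repeated value would be counted twice in the
      -- integral.
      { values              = deduplicate _≟_ (values s-simple ++ values t-simple)
      ; values-unique       = deduplicate-! decSetoid (values s-simple ++ values t-simple)
      ; range⊆values        = λ p → ∈-deduplicate⁺ S _≟_ (λ w≈v u≈v → trans u≈v (sym w≈v))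
                                      (range p)
      ; preimage-measurable = λ v → measurable-resp (from v , to v)
                                (∪-measurable
                                  (∩-measurable B-meas (preimage-measurable s-simple v))
                                  (∩-measurable (∁-measurable B-meas) (preimage-measurable t-simple v)))
      }
      where
      open IsSimple

      _≟_ : Decidable _≈_
      _ ≟ _ = em

      decSetoid : DecSetoid c 0ℓ
      decSetoid = record { isDecEquivalence = record { isEquivalence = isEquivalence ; _≟_ = _≟_ } }

      range : ∀ p → piecewise B s t p ∈ values s-simple ++ values t-simple
      range p with em {P = B p}
      ... | yes _ = ∈-++⁺ˡ S (range⊆values s-simple p)
      ... | no  _ = ∈-++⁺ʳ S (values s-simple) (range⊆values t-simple p)

      to : ∀ v → (λ p → piecewise B s t p ≈ v) ⊆ (B ∩ (λ p → s p ≈ v)) ∪ (∁ B ∩ (λ p → t p ≈ v))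
      to v {p} eq with em {P = B p}
      ... | yes b = inj₁ (b , eq)
      ... | no ¬b = inj₂ (¬b , eq)

      from : ∀ v → (B ∩ (λ p → s p ≈ v)) ∪ (∁ B ∩ (λ p → t p ≈ v)) ⊆ (λ p → piecewise B s t p ≈ v)
      from v (inj₁ (b , eq))  = trans (piecewise-∈ B s t b) eq
      from v (inj₂ (¬b , eq)) = trans (piecewise-∉ B s t ¬b) eq

    -- As `s` has finitely many values, the set is a finite union of intersections of a level set of
    -- `s` with some `R v`. Thus a condition involving `s p` need only be measurable for each fixed
    -- value.
    simple-substitution : ∀ {s} → IsSimple M S s → (R : Carrier → Pred Point 0ℓ) →
                          (∀ v → Measurable (R v)) → (∀ {v w p} → v ≈ w → R v p → R w p) →
                          Measurable (λ p → R (s p) p)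
    simple-substitution {s} s-simple R R-meas R-resp =
      measurable-resp ((λ {p} → from values {p}) , λ {p} → to values (range⊆values p)) (pieces-measurable values)
      where
      open IsSimple s-simple

      pieces : List Carrier → Pred Point 0ℓ
      pieces []      = ∅
      pieces (v ∷ L) = ((λ p → s p ≈ v) ∩ R v) ∪ pieces L

      pieces-measurable : ∀ L → Measurable (pieces L)
      pieces-measurable []      = ∅-measurable
      pieces-measurable (v ∷ L) =
        ∪-measurable (∩-measurable (preimage-measurable v) (R-meas v)) (pieces-measurable L)

      from : ∀ L → pieces L ⊆ (λ p → R (s p) p)
      from (v ∷ L) (inj₁ (s≈v , r)) = R-resp (sym s≈v) r
      from (v ∷ L) (inj₂ p∈)        = from L p∈

      to : ∀ L {p} → s p ∈ L → R (s p) p → pieces L p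
      to (v ∷ L) (here s≈v)  r = inj₁ (s≈v , R-resp s≈v r)
      to (v ∷ L) (there s∈L) r = inj₂ (to L s∈L r)

    measure-partition : ∀ {s} (s-simple : IsSimple M S s) A → let open IsSimple s-simple in
                        measure A ≈∞ ∑ values (λ v → measure (A ∩ₘ preimage s-simple v))
    measure-partition {s} s-simple A = partition A values values-unique (λ _ → range⊆values _)
      where
      open IsSimple s-simple

      -- Generalised over `A`: each step passes to the part of `A` outside one level set, and the
      -- shorter list still covers the values taken there.
      partition : ∀ A L → AllPairs (λ v w → ¬ v ≈ w) L → (∀ {p} → proj₁ A p → s p ∈ L) →
                  measure A ≈∞ ∑ L (λ v → measure (A ∩ₘ preimage s-simple v))
      partition A []      _                      A⊆ =
        measure-empty A (λ p a → case A⊆ a of λ ())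
      partition A (v ∷ L) (v∉L AllPairs.∷ uniq)  A⊆ = begin-equality
        measure A
          ≈⟨ measure-split A s≈v ⟩
        measure (s≈v ∩ₘ A) +∞ measure (∁ₘ s≈v ∩ₘ A)
          ≈⟨ +∞-cong (measure-cong (s≈v ∩ₘ A) (A ∩ₘ s≈v) (swap , swap))
                     (partition (∁ₘ s≈v ∩ₘ A) L uniq A⊆L) ⟩
        measure (A ∩ₘ s≈v) +∞ ∑ L (λ w → measure ((∁ₘ s≈v ∩ₘ A) ∩ₘ preimage s-simple w))
          -- The remaining values differ from `v`, so their level sets already avoid that of `v`.
          ≈⟨ +∞-cong ≈∞.refl (∑-cong-All L (All.map
               (λ {w} v≉w → measure-cong ((∁ₘ s≈v ∩ₘ A) ∩ₘ preimage s-simple w) (A ∩ₘ preimage s-simple w)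
                 ( (λ { ((_ , a) , s≈w) → a , s≈w })
                 , (λ { (a , s≈w) → ((λ s≈v → v≉w (trans (sym s≈v) s≈w)) , a) , s≈w })))
               v∉L)) ⟩
        measure (A ∩ₘ s≈v) +∞ ∑ L (λ w → measure (A ∩ₘ preimage s-simple w))
          ∎
        where
        s≈v : MeasurableSet
        s≈v = preimage s-simple v

        A⊆L : ∀ {p} → proj₁ (∁ₘ s≈v ∩ₘ A) p → s p ∈ L
        A⊆L (s≉v , a) with A⊆ a
        ... | here s≈v  = contradiction s≈v s≉v
        ... | there s∈L = s∈L

  -- Integrals of simple functions over measurable sets.

  private
    Simple : (Point → ℝ≥0) → Set (x ⊔ m)
    Simple = IsSimple M ℝ≥0-setoid

    level : ∀ {s} → Simple s → ℝ≥0 → MeasurableSet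
    level = preimage ℝ≥0-setoid

  -- Keeps the value list of `s` instead of forming `s` times an indicator, so that splitting along
  -- `B` is a computation within one list.
  integralOver : ∀ {s} → Simple s → MeasurableSet → [0,∞]
  integralOver s-simple B = ∑ values (λ v → v · measure (B ∩ₘ level s-simple v))
    where open IsSimple s-simple

  integralOver-split : ∀ {s} (s-simple : Simple s) B →
                       simpleIntegral M s-simple ≈∞ integralOver s-simple B +∞ integralOver s-simple (∁ₘ B)
  integralOver-split s-simple B = ≈∞.trans
    (∑-cong values (λ v → ≈∞.trans (·-congˡ v (measure-split (level s-simple v) B))
                                   (·-distribˡ-+∞ v (measure (B ∩ₘ level s-simple v)) (measure (∁ₘ B ∩ₘ level s-simple v)))))
    (∑-distrib-+∞ values _ _)
    where open IsSimple s-simple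

  -- Both sides are computed on the common refinement of the level sets of r
  -- and s, where the inequality holds cell by cell.
  integralOver-mono : ∀ {r s} (r-simple : Simple r) (s-simple : Simple s) B δ → 0# < proj₁ δ →
                      (∀ {p} → proj₁ B p → r p ≤₀ (δ *₀ s p)) →
                      integralOver r-simple B ≤∞ δ · integralOver s-simple B
  integralOver-mono {r} {s} r-simple s-simple B δ 0<δ r≤δs = begin
    ∑ Vr (λ z → z · measure (B ∩ₘ level r-simple z))
      ≈⟨ ∑-cong Vr (λ z → ≈∞.trans
           (·-congˡ z (measure-partition ℝ≥0-setoid s-simple (B ∩ₘ level r-simple z)))
           (·-distribˡ-∑ z Vs _)) ⟩
    ∑ Vr (λ z → ∑ Vs (λ v → z · measure ((B ∩ₘ level r-simple z) ∩ₘ level s-simple v)))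
      ≤⟨ ∑-mono Vr (λ z → ∑-mono Vs (cell z)) ⟩
    ∑ Vr (λ z → ∑ Vs (λ v → δ · (v · measure ((B ∩ₘ level s-simple v) ∩ₘ level r-simple z))))
      ≈⟨ ∑-swap Vr Vs _ ⟩
    ∑ Vs (λ v → ∑ Vr (λ z → δ · (v · measure ((B ∩ₘ level s-simple v) ∩ₘ level r-simple z))))
      ≈⟨ ∑-cong Vs (λ v → ≈∞.trans (·-congˡ δ (≈∞.trans
           (·-congˡ v (measure-partition ℝ≥0-setoid r-simple (B ∩ₘ level s-simple v)))
           (·-distribˡ-∑ v Vr _)))
           (·-distribˡ-∑ δ Vr _)) ⟨
    ∑ Vs (λ v → δ · (v · measure (B ∩ₘ level s-simple v)))
      ≈⟨ ·-distribˡ-∑ δ Vs _ ⟨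
    δ · ∑ Vs (λ v → v · measure (B ∩ₘ level s-simple v))
      ∎
    where
    Vr Vs : List ℝ≥0
    Vr = IsSimple.values r-simple
    Vs = IsSimple.values s-simple

    cell : ∀ z v → z · measure ((B ∩ₘ level r-simple z) ∩ₘ level s-simple v) ≤∞
                   δ · (v · measure ((B ∩ₘ level s-simple v) ∩ₘ level r-simple z))
    cell z v = begin
      z · measure rs         ≤⟨ by-cases (em {P = Satisfiable (proj₁ rs)}) ⟩
      (δ *₀ v) · measure rs  ≤⟨ ·-assoc-≤ {δ} 0<δ v (measure rs) ⟩
      δ · (v · measure rs)   ≈⟨ ·-congˡ δ (·-congˡ v (measure-cong rs sr
                                  ( (λ { ((b , r≈z) , s≈v) → (b , s≈v) , r≈z })
                                  , (λ { ((b , s≈v) , r≈z) → (b , r≈z) , s≈v })))) ⟩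
      δ · (v · measure sr)   ∎
      where
      rs sr : MeasurableSet
      rs = (B ∩ₘ level r-simple z) ∩ₘ level s-simple v
      sr = (B ∩ₘ level s-simple v) ∩ₘ level r-simple z

      -- The pointwise bound compares `z` with `v` only if the cell contains a point; an empty cell
      -- has measure zero.
      by-cases : Dec (Satisfiable (proj₁ rs)) → z · measure rs ≤∞ (δ *₀ v) · measure rs
      by-cases (yes (p , (b , r≈z) , s≈v)) = ·-monoˡ z≤δv (measure rs)
        where
        z≤δv : z ≤₀ (δ *₀ v)
        z≤δv = ℝ.≤-trans (ℝ.≤-reflexive (ℝ.sym r≈z))
                 (ℝ.≤-trans (r≤δs b) (ℝ.≤-reflexive (ℝ.*-congˡ s≈v)))
      by-cases (no rs-empty) = ≤∞-trans
        (≤∞-reflexive (·-zeroʳ z (measure-empty rs (λ p p∈ → rs-empty (p , p∈))))) (∞-minimum _)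

  -- The case `δ = 1#`. For functions that agree on `B` it lets one value list be exchanged for
  -- another.
  integralOver-cong-≤ : ∀ {r s} (r-simple : Simple r) (s-simple : Simple s) B →
                        (∀ {p} → proj₁ B p → r p ≤₀ s p) →
                        integralOver r-simple B ≤∞ integralOver s-simple B
  integralOver-cong-≤ r-simple s-simple B r≤s = ≤∞-trans
    (integralOver-mono r-simple s-simple B (1# , 0≤1) 0<1
      (λ b → ℝ.≤-trans (r≤s b) (ℝ.≤-reflexive (ℝ.sym (ℝ.*-identityˡ _)))))
    (≤∞-reflexive (·-identityˡ _))

  -- The integral as a supremum over simple minorants.

  IsIntegralSum : (Point → [0,∞]) → [0,∞] → Set (x ⊔ m)
  IsIntegralSum g t = Σ[ s ∈ (Point → ℝ≥0) ] Σ[ s-simple ∈ Simple s ]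
                        (∀ p → fin (s p) ≤∞ g p) × t ≈∞ simpleIntegral M s-simple

  ∫-isSupremum : ∀ g → IsLeastUpperBound _≤∞_ (IsIntegralSum g) (∫ M g)
  ∫-isSupremum g = sup-isLeastUpperBound (IsIntegralSum g)

  -- The function equal to `s` on `B` and to `t` off `B` is itself a simple minorant of `g`.
  integralOver-glue : ∀ {s t g} (s-simple : Simple s) (t-simple : Simple t) B →
                      (∀ {p} → proj₁ B p → fin (s p) ≤∞ g p) →
                      (∀ {p} → ¬ proj₁ B p → fin (t p) ≤∞ g p) →
                      integralOver s-simple B +∞ integralOver t-simple (∁ₘ B) ≤∞ ∫ M g
  integralOver-glue {s} {t} {g} s-simple t-simple B s≤g t≤g = begin
    integralOver s-simple B +∞ integralOver t-simple (∁ₘ B)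
      ≤⟨ +∞-mono (integralOver-cong-≤ s-simple r-simple B
                   (λ b → ℝ.≤-reflexive (ℝ.sym (piecewise-∈ ℝ≥0-setoid (proj₁ B) s t b))))
                 (integralOver-cong-≤ t-simple r-simple (∁ₘ B)
                   (λ ¬b → ℝ.≤-reflexive (ℝ.sym (piecewise-∉ ℝ≥0-setoid (proj₁ B) s t ¬b)))) ⟩
    integralOver r-simple B +∞ integralOver r-simple (∁ₘ B)
      ≈⟨ integralOver-split r-simple B ⟨
    simpleIntegral M r-simple
      ≤⟨ proj₁ (∫-isSupremum g) (_ , r-simple , r≤g , ≈∞.refl) ⟩
    ∫ M g
      ∎
    where
    r : Point → ℝ≥0
    r = piecewise ℝ≥0-setoid (proj₁ B) s t

    r-simple : Simple r
    r-simple = piecewise-simple ℝ≥0-setoid B s-simple t-simple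

    r≤g : ∀ p → fin (r p) ≤∞ g p
    r≤g p with em {P = proj₁ B p}
    ... | yes b = s≤g b
    ... | no ¬b = t≤g ¬b

  -- The minorant with value `η` on `B` and zero elsewhere already has integral `η · measure B`.
  chebyshev : ∀ {g} B η → 0# < proj₁ η → (∀ {p} → proj₁ B p → fin η ≤∞ g p) →
              IsFinite (∫ M g) → IsFinite (measure B)
  chebyshev {g} B η (_ , 0≉η) η≤g ∫g-finite =
    let H , ∫g≤H = finite⇒≤fin ∫g-finite
    in ·-finite⁻¹ η (0≉η ∘ ℝ.sym) (≤fin⇒finite (begin
      η · measure B
        ≈⟨ ·-congˡ η (measure-cong B (B ∩ₘ level η-simple η) ((λ b → b , ℝ.refl) , proj₁)) ⟩
      η · measure (B ∩ₘ level η-simple η)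
        ≈⟨ +∞-identityʳ _ ⟨
      integralOver η-simple B
        ≤⟨ a≤∞a+∞b _ _ ⟩
      integralOver η-simple B +∞ integralOver 0-simple (∁ₘ B)
        ≤⟨ integralOver-glue η-simple 0-simple B η≤g (λ _ → ∞-minimum _) ⟩
      ∫ M g
        ≤⟨ ∫g≤H ⟩
      fin H
        ∎))
    where
    η-simple : Simple (λ _ → η)
    η-simple = constant-simple ℝ≥0-setoid η

    0-simple : Simple (λ _ → 0₀)
    0-simple = constant-simple ℝ≥0-setoid 0₀

  -- Continuity of the measure is applied to each level set separately. For a nonzero value, the
  -- level set lies in the support, hence in the union of the `A k`, and has finite measure because
  -- its term in the integral is finite.
  integralOver-continuous : ∀ {s} (s-simple : Simple s) (A : ℕ → MeasurableSet) →
                            (∀ {p} → 0# < proj₁ (s p) → ∃[ k ] proj₁ (A k) p) →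
                            IsFinite (simpleIntegral M s-simple) → ∀ η → 0# < proj₁ η →
                            ∃[ N ] ∀ n → N ℕ.≤ n →
                            simpleIntegral M s-simple ≤∞ integralOver s-simple (firstₘ A n) +∞ fin η
  integralOver-continuous {s} s-simple A support⊆⋃A = go values
    where
    open IsSimple s-simple

    term : ∀ v → IsFinite (v · measure (level s-simple v)) → ∀ η → 0# < proj₁ η →
           ∃[ N ] ∀ n → N ℕ.≤ n →
           v · measure (level s-simple v) ≤∞ v · measure (firstₘ A n ∩ₘ level s-simple v) +∞ fin η
    term v v·μ-finite η 0<η with em {P = proj₁ v ℝ.≈ 0#}
    -- The zero level set may have infinite measure and need not be covered, but its term vanishes.
    ... | yes v≈0 = 0 , λ _ _ → ≤∞-trans (≤∞-reflexive (0·a≈0 v v≈0 (measure (level s-simple v)))) (∞-minimum _)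
    ... | no  v≉0 with ∃-scaling (proj₂ v) 0<η
    ...   | ε , 0<ε@(0≤ε , _) , εv≤η =
      let N , close = measure-continuous A C C⊆⋃A (·-finite⁻¹ v {measure C} v≉0 v·μ-finite) (ε , 0≤ε) 0<ε
      in N , λ n N≤n → begin
        v · measure C                                          ≤⟨ ·-monoʳ v (close n N≤n) ⟩
        v · (measure (firstₘ A n ∩ₘ C) +∞ fin (ε , 0≤ε))       ≈⟨ ·-distribˡ-+∞ v (measure (firstₘ A n ∩ₘ C)) (fin (ε , 0≤ε)) ⟩
        v · measure (firstₘ A n ∩ₘ C) +∞ v · fin (ε , 0≤ε)     ≤⟨ +∞-mono ≤∞-refl vε≤η ⟩
        v · measure (firstₘ A n ∩ₘ C) +∞ fin η                 ∎
      where
      C : MeasurableSet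
      C = level s-simple v

      C⊆⋃A : proj₁ C ⊆ ⋃ ℕ (proj₁ ∘ A)
      C⊆⋃A {p} s≈v = support⊆⋃A (proj₂ (s p) , λ 0≈s → v≉0 (ℝ.trans (ℝ.sym s≈v) (ℝ.sym 0≈s)))

      vε≤η : v · fin (ε , 0≤ε) ≤∞ fin η
      vε≤η = AddSupremum.[ ℝ.≤-trans (ℝ.≤-reflexive (ℝ.*-comm (proj₁ v) ε)) εv≤η ]

    go : ∀ L → IsFinite (∑ L (λ v → v · measure (level s-simple v))) → ∀ η → 0# < proj₁ η →
         ∃[ N ] ∀ n → N ℕ.≤ n →
         ∑ L (λ v → v · measure (level s-simple v)) ≤∞
         ∑ L (λ v → v · measure (firstₘ A n ∩ₘ level s-simple v)) +∞ fin η
    go []      _        η _   = 0 , λ _ _ → ∞-minimum _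
    -- Half of the tolerance goes to the head and half to the whole tail, so the length of the list
    -- never enters.
    go (v ∷ L) ∑-finite η 0<η with ∃-half 0<η | finite⇒≤fin ∑-finite
    ... | ζ , 0<ζ@(0≤ζ , _) , ζ+ζ≤η | b , ∑≤b =
      let N₁ , close₁ = term v (≤fin⇒finite (≤∞-trans (a≤∞a+∞b _ _) ∑≤b)) (ζ , 0≤ζ) 0<ζ
          N₂ , close₂ = go L (≤fin⇒finite (≤∞-trans (≤∞-trans (a≤∞a+∞b _ _)
                               (≤∞-reflexive (+∞-comm _ (v · measure (level s-simple v))))) ∑≤b)) (ζ , 0≤ζ) 0<ζ
      in N₁ ℕ.⊔ N₂ , λ n N≤n → begin
        ∑ (v ∷ L) (λ v → v · measure (level s-simple v))
          ≤⟨ +∞-mono (close₁ n (ℕ.≤-trans (ℕ.m≤m⊔n N₁ N₂) N≤n))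
                     (close₂ n (ℕ.≤-trans (ℕ.m≤n⊔m N₁ N₂) N≤n)) ⟩
        _ +∞ fin (ζ , 0≤ζ) +∞ (_ +∞ fin (ζ , 0≤ζ))
          ≈⟨ interchange _ _ _ _ ⟩
        ∑ (v ∷ L) (λ v → v · measure (firstₘ A n ∩ₘ level s-simple v)) +∞ (fin (ζ , 0≤ζ) +∞ fin (ζ , 0≤ζ))
          ≤⟨ +∞-mono ≤∞-refl AddSupremum.[ ζ+ζ≤η ] ⟩
        ∑ (v ∷ L) (λ v → v · measure (firstₘ A n ∩ₘ level s-simple v)) +∞ fin η
          ∎

  -- Convergence of integrals under a dominating function.

  module _ {g : Point → [0,∞]} {h d : ℕ → Point → ℝ≥0}
           (d-meas : ∀ k c → Measurable (λ p → proj₁ (d k p) < c))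
           (d-small : ∀ p ε → 0# < ε → ∃[ k ] proj₁ (d k p) < ε)
           (h≤g : ∀ n p → fin (h n p) ≤∞ g p)
           (h≤d : ∀ {k n} → k ℕ.< n → ∀ p → h n p ≤₀ d k p) where

    module _ {φ : Point → ℝ≥0} (φ-simple : Simple φ) (φ≤g : ∀ p → fin (φ p) ≤∞ g p) {ζ H : ℝ≥0}
             (∫g≤∫φ+ζ : ∫ M g ≤∞ simpleIntegral M φ-simple +∞ fin ζ) (∫g≤H : ∫ M g ≤∞ fin H)
             (0<ζ : 0# < proj₁ ζ) {δ : ℝ≥0} (0<δ : 0# < proj₁ δ) (δH≤ζ : (δ *₀ H) ≤₀ ζ) where
      private
        A : ℕ → MeasurableSet
        A k = (λ p → proj₁ (d k p) < proj₁ δ * proj₁ (φ p)) ,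
          simple-substitution ℝ≥0-setoid φ-simple (λ v p → proj₁ (d k p) < proj₁ δ * proj₁ v)
            (λ v → d-meas k (proj₁ δ * proj₁ v))
            (λ v≈w dk<δv → <-≤-trans dk<δv (ℝ.≤-reflexive (ℝ.*-congˡ v≈w)))

        ∫φ≤H : simpleIntegral M φ-simple ≤∞ fin H
        ∫φ≤H = ≤∞-trans (proj₁ (∫-isSupremum g) (φ , φ-simple , φ≤g , ≈∞.refl)) ∫g≤H

        ∫ᴬφ≤H : ∀ B → integralOver φ-simple B ≤∞ fin H
        ∫ᴬφ≤H B = begin
          integralOver φ-simple B                                   ≤⟨ a≤∞a+∞b _ _ ⟩
          integralOver φ-simple B +∞ integralOver φ-simple (∁ₘ B)   ≈⟨ integralOver-split φ-simple B ⟨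
          simpleIntegral M φ-simple                                 ≤⟨ ∫φ≤H ⟩
          fin H                                                     ∎

        module _ (n : ℕ)
                 (∫φ≤∫ᴬφ+ζ : simpleIntegral M φ-simple ≤∞ integralOver φ-simple (firstₘ A n) +∞ fin ζ)
                 {t : Point → ℝ≥0} (t-simple : Simple t) (t≤h : ∀ p → fin (t p) ≤∞ fin (h n p)) where
          B : MeasurableSet
          B = firstₘ A n

          t≤δφ : ∀ {p} → proj₁ B p → t p ≤₀ (δ *₀ φ p)
          t≤δφ {p} p∈B with firstₘ⁻ A n p∈B | t≤h p
          ... | k , k<n , dk<δφ | AddSupremum.[ t≤hn ] = ℝ.≤-trans t≤hn (ℝ.≤-trans (h≤d k<n p) (<⇒≤ dk<δφ))

          on-B : integralOver t-simple B ≤∞ fin ζ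
          on-B = begin
            integralOver t-simple B       ≤⟨ integralOver-mono t-simple φ-simple B δ 0<δ t≤δφ ⟩
            δ · integralOver φ-simple B   ≤⟨ ·-monoʳ δ (∫ᴬφ≤H B) ⟩
            δ · fin H                     ≤⟨ AddSupremum.[ δH≤ζ ] ⟩
            fin ζ                         ∎

          off-B : integralOver t-simple (∁ₘ B) ≤∞ fin ζ +∞ fin ζ
          -- Instead of subtracting the integral of `φ` over `B`, it is added on both sides and
          -- cancelled, which its finiteness permits.
          off-B = +∞-cancelʳ-≤ (≤fin⇒finite (∫ᴬφ≤H B)) (begin
            integralOver t-simple (∁ₘ B) +∞ integralOver φ-simple B
              ≈⟨ +∞-comm (integralOver t-simple (∁ₘ B)) (integralOver φ-simple B) ⟩
            integralOver φ-simple B +∞ integralOver t-simple (∁ₘ B)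
              ≤⟨ integralOver-glue φ-simple t-simple B (λ {p} _ → φ≤g p) (λ {p} _ → ≤∞-trans (t≤h p) (h≤g n p)) ⟩
            ∫ M g
              ≤⟨ ∫g≤∫φ+ζ ⟩
            simpleIntegral M φ-simple +∞ fin ζ
              ≤⟨ +∞-mono ∫φ≤∫ᴬφ+ζ ≤∞-refl ⟩
            integralOver φ-simple B +∞ fin ζ +∞ fin ζ
              ≈⟨ +∞-assoc (integralOver φ-simple B) (fin ζ) (fin ζ) ⟩
            integralOver φ-simple B +∞ (fin ζ +∞ fin ζ)
              ≈⟨ +∞-comm (integralOver φ-simple B) (fin ζ +∞ fin ζ) ⟩
            fin ζ +∞ fin ζ +∞ integralOver φ-simple B
              ∎)

          simpleIntegral-small : simpleIntegral M t-simple ≤∞ fin ζ +∞ (fin ζ +∞ fin ζ)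
          simpleIntegral-small = ≤∞-trans (≤∞-reflexive (integralOver-split t-simple B)) (+∞-mono on-B off-B)

      -- `N` depends only on how fast the sets `firstₘ A n` exhaust the integral of `φ`; it
      -- therefore serves every simple minorant of `h n` at once.
      ∫-eventually-small : ∃[ N ] ∀ n → N ℕ.≤ n → ∫ M (λ p → fin (h n p)) ≤∞ fin ζ +∞ (fin ζ +∞ fin ζ)
      ∫-eventually-small =
        let N , exhausted = integralOver-continuous φ-simple A
              (λ {p} 0<φ → d-small p (proj₁ δ * proj₁ (φ p)) (*-positive 0<δ 0<φ)) (≤fin⇒finite ∫φ≤H) ζ 0<ζ
        in N , λ n N≤n → proj₂ (∫-isSupremum (λ p → fin (h n p)))
             (λ { (t , t-simple , t≤h , b≈∫t) →
                  ≤∞-trans (≤∞-reflexive b≈∫t) (simpleIntegral-small n (exhausted n N≤n) t-simple t≤h) })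

    ∫-tendsToZero : IsFinite (∫ M g) → TendsToZero (λ n → ∫ M (λ p → fin (h n p)))
    ∫-tendsToZero ∫g-finite ε 0<ε =
      let ζ , 0<ζ , 3ζ<ε  = ∃-third 0<ε
          ζ₀              = ζ , <⇒≤ 0<ζ
          H , ∫g≤H        = finite⇒≤fin ∫g-finite
          δ , 0<δ , δH≤ζ  = ∃-scaling (proj₂ H) 0<ζ
          a , (φ , φ-simple , φ≤g , a≈∫φ) , ∫g≤a+ζ = supremum-approximated (∫-isSupremum g) ∫g≤H
            -- The zero function is a minorant, so there is something to take the supremum of.
            (_ , _ , constant-simple ℝ≥0-setoid 0₀ , (λ p → ∞-minimum (g p)) , ≈∞.refl) ζ₀ 0<ζ
          N , ∫h≤3ζ       = ∫-eventually-small φ-simple φ≤g {ζ₀} {H}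
            (≤∞-trans ∫g≤a+ζ (+∞-mono (≤∞-reflexive a≈∫φ) ≤∞-refl)) ∫g≤H 0<ζ {δ , <⇒≤ 0<δ} 0<δ δH≤ζ
      in N , λ n N≤n → ≤fin∧<⇒<∞ (∫h≤3ζ n N≤n) 3ζ<ε

-- Norm inequalities and open sets given by distances.

module BanachProperties
  (em : ∀ {ℓ : Level} → ExcludedMiddle ℓ) (ℝ : CompleteOrderedField)
  {e : Level} (E : Analysis.BanachSpace em ℝ e) where

  open Analysis em ℝ
  open CompleteOrderedField ℝ
  open OrderedFieldProperties ℝ
  open BanachSpace E hiding (setoid)
  open AbelianGroupProperties +ᴹ-abelianGroup using (inverseˡ-unique; ⁻¹-anti-homo‿-; ε⁻¹≈ε; //-rightDividesˡ)

  -1*v≈-v : ∀ v → (- 1#) *ₗ v ≈ᴹ -ᴹ v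
  -1*v≈-v v = inverseˡ-unique ((- 1#) *ₗ v) v (begin
    (- 1#) *ₗ v +ᴹ v          ≈⟨ +ᴹ-congˡ (*ₗ-identityˡ v) ⟨
    (- 1#) *ₗ v +ᴹ 1# *ₗ v    ≈⟨ *ₗ-distribʳ v (- 1#) 1# ⟨
    (- 1# + 1#) *ₗ v          ≈⟨ *ₗ-congʳ (-‿inverseˡ 1#) ⟩
    0# *ₗ v                   ≈⟨ *ₗ-zeroˡ v ⟩
    0ᴹ                        ∎)
    where open SetoidReasoning ≈ᴹ-setoid

  open ℝ-≤-Reasoning

  ‖-v‖≈‖v‖ : ∀ v → ‖ -ᴹ v ‖ ≈ ‖ v ‖
  ‖-v‖≈‖v‖ v = begin-equality
    ‖ -ᴹ v ‖          ≈⟨ ‖‖-cong (-1*v≈-v v) ⟨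
    ‖ (- 1#) *ₗ v ‖   ≈⟨ ‖‖-homogeneous (- 1#) v ⟩
    ∣ - 1# ∣ * ‖ v ‖  ≈⟨ *-congʳ (trans (∣-x∣≈∣x∣ 1#) (∣x∣≈x 0≤1)) ⟩
    1# * ‖ v ‖        ≈⟨ *-identityˡ ‖ v ‖ ⟩
    ‖ v ‖             ∎

  ‖v-w‖≈‖w-v‖ : ∀ v w → ‖ v -ᴹ w ‖ ≈ ‖ w -ᴹ v ‖
  ‖v-w‖≈‖w-v‖ v w = trans (sym (‖-v‖≈‖v‖ (v -ᴹ w))) (‖‖-cong (⁻¹-anti-homo‿- v w))

  ‖v-0‖≈‖v‖ : ∀ v → ‖ v -ᴹ 0ᴹ ‖ ≈ ‖ v ‖
  ‖v-0‖≈‖v‖ v = ‖‖-cong (≈ᴹ-trans (+ᴹ-congˡ ε⁻¹≈ε) (+ᴹ-identityʳ v))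

  ‖v-w‖≤‖v-z‖+‖z-w‖ : ∀ v z w → ‖ v -ᴹ w ‖ ≤ ‖ v -ᴹ z ‖ + ‖ z -ᴹ w ‖
  ‖v-w‖≤‖v-z‖+‖z-w‖ v z w = begin
    ‖ v -ᴹ w ‖                  ≈⟨ ‖‖-cong (+ᴹ-congʳ (//-rightDividesˡ z v)) ⟨
    ‖ v -ᴹ z +ᴹ z -ᴹ w ‖        ≈⟨ ‖‖-cong (+ᴹ-assoc (v -ᴹ z) z (-ᴹ w)) ⟩
    ‖ (v -ᴹ z) +ᴹ (z -ᴹ w) ‖    ≤⟨ ‖‖-triangle _ _ ⟩
    ‖ v -ᴹ z ‖ + ‖ z -ᴹ w ‖     ∎

  ‖v‖-positive : ∀ {v} → ¬ v ≈ᴹ 0ᴹ → 0# < ‖ v ‖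
  ‖v‖-positive v≉0 = ‖‖-nonneg _ , λ 0≈‖v‖ → v≉0 (‖‖-definite (sym 0≈‖v‖))

  -- Lipschitz constant one. The one-sided bound suffices, since `v` and `w` may be exchanged.
  Lipschitz : (Carrierᴹ → Carrier) → Set e
  Lipschitz g = ∀ v w → g v ≤ g w + ‖ v -ᴹ w ‖

  distance-lipschitz : ∀ z → Lipschitz (λ v → ‖ v -ᴹ z ‖)
  distance-lipschitz z v w = ≤-trans (‖v-w‖≤‖v-z‖+‖z-w‖ v w z) (≤-reflexive (+-comm _ _))

  constant-lipschitz : ∀ c → Lipschitz (λ _ → c)
  constant-lipschitz c v w = x≤x+y c (‖‖-nonneg _)

  -- Within half the gap `k v - g v`, neither side can move far enough to close it. With
  -- `distance-lipschitz` and `constant-lipschitz` this covers comparing two distances as well as a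
  -- distance with a constant.
  <-open : ∀ {g k} → Lipschitz g → Lipschitz k → IsOpen (λ v → g v < k v)
  <-open {g} {k} g-lip k-lip v gv<kv with ∃-half (x<y⇒0<y-x gv<kv)
  ... | ε , 0<ε , ε+ε≤kv-gv = ε , 0<ε , λ w ‖w-v‖<ε → +-cancelʳ-< ε (begin-strict
    g w + ε                      ≤⟨ +-monoˡ-≤ ε (g-lip w v) ⟩
    g v + ‖ w -ᴹ v ‖ + ε         ≤⟨ +-monoˡ-≤ ε (+-monoʳ-≤ (g v) (<⇒≤ ‖w-v‖<ε)) ⟩
    g v + ε + ε                  ≈⟨ +-assoc (g v) ε ε ⟩
    g v + (ε + ε)                ≤⟨ +-monoʳ-≤ (g v) ε+ε≤kv-gv ⟩
    g v + (k v - g v)            ≈⟨ +-comm (g v) _ ⟩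
    k v - g v + g v              ≈⟨ x-y+y≈x (k v) (g v) ⟩
    k v                          ≤⟨ k-lip v w ⟩
    k w + ‖ v -ᴹ w ‖             ≈⟨ +-congˡ (‖v-w‖≈‖w-v‖ v w) ⟩
    k w + ‖ w -ᴹ v ‖             ≈⟨ +-comm (k w) _ ⟩
    ‖ w -ᴹ v ‖ + k w             <⟨ +-monoˡ-< (k w) ‖w-v‖<ε ⟩
    ε + k w                      ≈⟨ +-comm ε (k w) ⟩
    k w + ε                      ∎)

-- Approximation by the nearest point so far.

module NearestPointApproximation
  (em : ∀ {ℓ : Level} → ExcludedMiddle ℓ) (ℝ : CompleteOrderedField)
  {x m e : Level} (M : Analysis.MeasureSpace em ℝ x m) (E : Analysis.BanachSpace em ℝ e)
  (f : Analysis.MeasureSpace.Point M → Analysis.BanachSpace.Carrierᴹ E)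
  (u : ℕ → Analysis.BanachSpace.Carrierᴹ E)
  (f-measurable : Analysis.IsBorelMeasurable em ℝ M E f) where

  open Analysis em ℝ
  open MeasureSpace M
  open BanachSpace E renaming (setoid to E-setoid)
  open CompleteOrderedField ℝ
  open OrderedFieldProperties ℝ
  open ExtendedProperties em ℝ
  open MeasureProperties em ℝ M
  open BanachProperties em ℝ E
  open ℝ-≤-Reasoning

  -- A running minimum: `nearest n p` minimises the distance to `f p` among `0ᴹ` and the `u k` with
  -- `k < n`. The competitor `0ᴹ` is the source of the domination by `‖f‖`.
  nearest : ℕ → Point → Carrierᴹ

  closer : ℕ → Pred Point 0ℓ
  closer n p = ‖ f p -ᴹ u n ‖ < ‖ f p -ᴹ nearest n p ‖

  nearest zero    = λ _ → 0ᴹ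
  nearest (suc n) = piecewise E-setoid (closer n) (λ _ → u n) (nearest n)

  nearest-simple : ∀ n → IsSimple M E-setoid (nearest n)
  nearest-simple zero    = constant-simple E-setoid 0ᴹ
  nearest-simple (suc n) = piecewise-simple E-setoid (closer n , closer-measurable)
                             (constant-simple E-setoid (u n)) (nearest-simple n)
    where
    closer-measurable : Measurable (closer n)
    -- `nearest n p` varies with `p`, but once it is replaced by one of its finitely many values
    -- `v`, the condition is the preimage under `f` of an open set.
    closer-measurable = simple-substitution E-setoid (nearest-simple n)
      (λ v p → ‖ f p -ᴹ u n ‖ < ‖ f p -ᴹ v ‖)
      (λ v → f-measurable (borel-open (<-open (distance-lipschitz (u n)) (distance-lipschitz v))))
      (λ v≈w lt → <-≤-trans lt (≤-reflexive (‖‖-cong (+ᴹ-congˡ (-ᴹ‿cong v≈w)))))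

  error : ℕ → Point → Carrier
  error n p = ‖ f p -ᴹ nearest n p ‖

  error-suc-≤ : ∀ n p → error (suc n) p ≤ error n p
  error-suc-≤ n p with em {P = closer n p}
  ... | yes cl = <⇒≤ cl
  ... | no  _  = ≤-refl

  error-suc-≤-‖f-u‖ : ∀ n p → error (suc n) p ≤ ‖ f p -ᴹ u n ‖
  error-suc-≤-‖f-u‖ n p with em {P = closer n p}
  ... | yes _  = ≤-refl
  ... | no ¬cl = ≮⇒≥ _≈_ _≤_ sym (λ _ _ → em) ≤-reflexive total ¬cl

  error≤‖f‖ : ∀ n p → error n p ≤ ‖ f p ‖
  error≤‖f‖ zero    p = ≤-reflexive (‖v-0‖≈‖v‖ (f p))
  error≤‖f‖ (suc n) p = ≤-trans (error-suc-≤ n p) (error≤‖f‖ n p)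

  -- The bound holds at stage `suc k`, where `u k` is compared, and persists because the error never
  -- increases.
  error≤‖f-u‖ : ∀ {k n} → k ℕ.< n → ∀ p → error n p ≤ ‖ f p -ᴹ u k ‖
  error≤‖f-u‖ {k} {suc n} (ℕ.s≤s k≤n) p with ℕ.m≤n⇒m<n∨m≡n k≤n
  ... | inj₁ k<n    = ≤-trans (error-suc-≤ n p) (error≤‖f-u‖ k<n p)
  ... | inj₂ ≡.refl = error-suc-≤-‖f-u‖ n p

  nearest-converges : ∀ p → (∀ ε → 0# < ε → ∃[ k ] ‖ f p -ᴹ u k ‖ < ε) →
                      ConvergesTo (λ n → nearest n p) (f p)
  nearest-converges p dense ε 0<ε with dense ε 0<ε
  ... | k , ‖f-u‖<ε = suc k , λ n k<n → begin-strict
    ‖ nearest n p -ᴹ f p ‖   ≈⟨ ‖v-w‖≈‖w-v‖ _ _ ⟩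
    error n p                ≤⟨ error≤‖f-u‖ k<n p ⟩
    ‖ f p -ᴹ u k ‖           <⟨ ‖f-u‖<ε ⟩
    ε                        ∎

  ‖nearest‖≤2‖f‖ : ∀ n p → ‖ nearest n p ‖ ≤ ‖ f p ‖ + ‖ f p ‖
  ‖nearest‖≤2‖f‖ n p = begin
    ‖ nearest n p ‖                                  ≈⟨ ‖v-0‖≈‖v‖ _ ⟨
    ‖ nearest n p -ᴹ 0ᴹ ‖                            ≤⟨ ‖v-w‖≤‖v-z‖+‖z-w‖ _ (f p) _ ⟩
    ‖ nearest n p -ᴹ f p ‖ + ‖ f p -ᴹ 0ᴹ ‖           ≤⟨ +-mono-≤ (≤-trans (≤-reflexive (‖v-w‖≈‖w-v‖ _ _)) (error≤‖f‖ n p))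
                                                          (≤-reflexive (‖v-0‖≈‖v‖ (f p))) ⟩
    ‖ f p ‖ + ‖ f p ‖                                ∎

  nearest-integrable : IsFinite (∫ M (λ p → norm∞ (f p))) → ∀ n → IsIntegrableSimple M E (nearest n)
  nearest-integrable ∫-finite n = record
    { isSimple        = nearest-simple n
    ; preimage-finite = finite
    }
    where
    finite : ∀ v → ¬ v ≈ᴹ 0ᴹ → IsFinite (measure (preimage E-setoid (nearest-simple n) v))
    -- Half of `‖ v ‖` bounds `‖f‖` from below on the level set, since `nearest n` is at most twice
    -- as large as `f` in norm.
    finite v v≉0 with ∃-half (‖v‖-positive v≉0)
    ... | η , 0<η@(0≤η , _) , η+η≤‖v‖ =
      chebyshev (preimage E-setoid (nearest-simple n) v) (η , 0≤η) 0<η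
        (λ nearest≈v → AddSupremum.[ η≤‖f‖ nearest≈v ]) ∫-finite
      where
      η≤‖f‖ : ∀ {p} → nearest n p ≈ᴹ v → η ≤ ‖ f p ‖
      η≤‖f‖ {p} nearest≈v = x+x≤y+y⇒x≤y (begin
        η + η               ≤⟨ η+η≤‖v‖ ⟩
        ‖ v ‖               ≈⟨ ‖‖-cong nearest≈v ⟨
        ‖ nearest n p ‖     ≤⟨ ‖nearest‖≤2‖f‖ n p ⟩
        ‖ f p ‖ + ‖ f p ‖   ∎)

mainTheorem1 : (em : ∀ {ℓ : Level} → ExcludedMiddle ℓ) (ℝ : CompleteOrderedField) →
    let open CompleteOrderedField ℝ using (_<_)
        open CompleteOrderedField ℝ using (0#)
        open Analysis em ℝ in
    ∀ {x m e : Level} (M : MeasureSpace x m) →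
    let open MeasureSpace M in
    Point →
    (E : BanachSpace e) →
    let open BanachSpace E in
    (f : Point → Carrierᴹ) (u : ℕ → Carrierᴹ) →
    IsBorelMeasurable M E f →
    (∀ y → (∃[ p ] f p ≈ᴹ y) → ∀ ε → 0# < ε → ∃[ n ] ‖ y -ᴹ u n ‖ < ε) →
    IsFinite (∫ M (λ p → norm∞ (f p))) →
    IsBochnerIntegrable M E f
mainTheorem1 em ℝ M _ E f u f-measurable dense ∫-finite =
  nearest ,
  nearest-integrable ∫-finite ,
  (λ p → nearest-converges p (dense (f p) (p , ≈ᴹ-refl))) ,
  ∫-tendsToZero
    {d = λ k p → ‖ f p -ᴹ u k ‖ , ‖‖-nonneg _}
    -- For a fixed bound `c` the set is the preimage of an open ball around `u k`.
    (λ k c → f-measurable (borel-open (<-open (distance-lipschitz (u k)) (constant-lipschitz c))))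
    -- The density behind pointwise convergence is used again: it makes the sets where some `u k` is
    -- within `δ φ` of `f` cover the support of `φ`.
    (λ p → dense (f p) (p , ≈ᴹ-refl))
    (λ n p → AddSupremum.[ error≤‖f‖ n p ])
    error≤‖f-u‖
    ∫-finite
  where
  open Analysis em ℝ
  open BanachSpace E
  open BanachProperties em ℝ E
  open MeasureProperties em ℝ M
  open NearestPointApproximation em ℝ M E f u f-measurable
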